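{- Let $\Pi$ be a DatalogMTL$^{FP}$ program and $D$ a database. For each predicate $P$ in $\Pi$ there exist a time point $T$ and a positive integer $n$ such that for all $x\in\mathbb N$ and all tuples $\boldsymbol\tau$: $P(\boldsymbol\tau)@(T+n x)\in\Pi(D)$ iff $P(\boldsymbol\tau)@T\in\Pi(D)$.
   Context: DatalogMTL over $\mathbb Q$ with continuous semantics. A DatalogMTL$^{FP}$ (forward propagating) program is a finite set of rules of the forms $P_1(\boldsymbol\tau_1)\land\dots\land P_n(\boldsymbol\tau_n)\to P_0(\boldsymbol\tau_0)$ ($n\ge0$), $\boxminus_\varrho P_1(\boldsymbol\tau_1)\to P_0(\boldsymbol\tau_0)$ and $\Diamond^-_\varrho P_1(\boldsymbol\tau_1)\to P_0(\boldsymbol\tau_0)$ with non-negative intervals $\varrho$; $\mathfrak M,t\models\boxminus_\varrho A$ iff $A$ holds at all $s$ with $t-s\in\varrho$, and $\mathfrak M,t\models\Diamond^-_\varrho A$ iff $A$ holds at some $s$ with $t-s\in\varrho$. A rule is satisfied if for every grounding and time $t$, body true at $t$ implies head true at $t$. A database is a finite set of facts $A@\varrho$ ($A$ ground atom, $\varrho$ interval). $\Pi(D)$ is the minimum model of $\Pi$ and $D$, and $P(\boldsymbol\tau)@t\in\Pi(D)$ means the ground atom holds at $t$ in it. -}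

module Defs where

open import Level using (Level; 0ℓ) renaming (suc to lsuc)
open import Data.Nat as ℕ using (ℕ)
open import Data.Integer using (+_)
open import Data.Rational using (ℚ; _+_; _-_; _/_; 0ℚ) renaming (_≤_ to _≤ℚ_; _<_ to _<ℚ_)
open import Data.List using (List)
open import Data.List.Relation.Unary.All using (All)
open import Data.List.Relation.Unary.Any using (Any)
open import Data.List.Membership.Propositional using (_∈_)
open import Data.Product using (Σ; _×_; ∃)
open import Data.Sum using (_⊎_)
open import Data.Unit using (⊤)
open import Relation.Binary.PropositionalEquality using (_≡_)

Pred : Set
Pred = ℕ

Const : Set
Const = ℕ

Var : Set
Var = ℕ

data Term : Set where
  var   : Var → Term
  const : Const → Term

record Atom : Set where
  constructor atom
  field
    pred : Pred
    args : List Term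

data LBound : Set where
  -∞     : LBound
  closedL : ℚ → LBound
  openL   : ℚ → LBound

data UBound : Set where
  +∞     : UBound
  closedU : ℚ → UBound
  openU   : ℚ → UBound

record Interval : Set where
  constructor ⟨_,_⟩
  field
    lower : LBound
    upper : UBound

aboveL : LBound → ℚ → Set
aboveL -∞          t = ⊤
aboveL (closedL q) t = q ≤ℚ t
aboveL (openL q)   t = q <ℚ t

belowU : UBound → ℚ → Set
belowU +∞          t = ⊤
belowU (closedU q) t = t ≤ℚ q
belowU (openU q)   t = t <ℚ q

_∈I_ : ℚ → Interval → Set
t ∈I ⟨ l , u ⟩ = aboveL l t × belowU u t

NonNegative : Interval → Set
NonNegative ϱ = ∀ t → t ∈I ϱ → 0ℚ ≤ℚ t

data Rule : Set where
  -- P₁(τ₁) ∧ … ∧ Pₙ(τₙ) → P₀(τ₀)   (n ≥ 0)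
  plain   : List Atom → Atom → Rule
  -- ⊟_ϱ P₁(τ₁) → P₀(τ₀)
  boxR    : Interval → Atom → Atom → Rule
  -- ◇⁻_ϱ P₁(τ₁) → P₀(τ₀)
  diamondR : Interval → Atom → Atom → Rule

RuleFP : Rule → Set
RuleFP (plain _ _)      = ⊤
RuleFP (boxR ϱ _ _)     = NonNegative ϱ
RuleFP (diamondR ϱ _ _) = NonNegative ϱ

Program : Set
Program = List Rule

IsFP : Program → Set
IsFP Π = All RuleFP Π

atomsOf : Rule → List Atom
atomsOf (plain body h)    = h Data.List.∷ body
atomsOf (boxR _ a h)      = h Data.List.∷ a Data.List.∷ Data.List.[]
atomsOf (diamondR _ a h)  = h Data.List.∷ a Data.List.∷ Data.List.[]

PredInProgram : Pred → Program → Set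
PredInProgram P Π = Any (λ r → Any (λ a → Atom.pred a ≡ P) (atomsOf r)) Π

record Fact : Set where
  constructor _⟨_⟩at_
  field
    fpred : Pred
    fargs : List Const
    finterval : Interval

Database : Set
Database = List Fact

Interpretation : Set₁
Interpretation = Pred → List Const → ℚ → Set

Substitution : Set
Substitution = Var → Const

groundTerm : Substitution → Term → Const
groundTerm σ (var x)   = σ x
groundTerm σ (const c) = c

groundArgs : Substitution → List Term → List Const
groundArgs σ = Data.List.map (groundTerm σ)

HoldsAt : Interpretation → Substitution → Atom → ℚ → Set
HoldsAt M σ (atom P τ) t = M P (groundArgs σ τ) t

BoxHolds : Interpretation → Substitution → Interval → Atom → ℚ → Set
BoxHolds M σ ϱ A t = ∀ s → (t - s) ∈I ϱ → HoldsAt M σ A s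

DiamondHolds : Interpretation → Substitution → Interval → Atom → ℚ → Set
DiamondHolds M σ ϱ A t = ∃ λ s → (t - s) ∈I ϱ × HoldsAt M σ A s

SatRule : Interpretation → Rule → Set
SatRule M (plain body h) =
  ∀ (σ : Substitution) (t : ℚ) → All (λ a → HoldsAt M σ a t) body → HoldsAt M σ h t
SatRule M (boxR ϱ a h) =
  ∀ (σ : Substitution) (t : ℚ) → BoxHolds M σ ϱ a t → HoldsAt M σ h t
SatRule M (diamondR ϱ a h) =
  ∀ (σ : Substitution) (t : ℚ) → DiamondHolds M σ ϱ a t → HoldsAt M σ h t

SatFact : Interpretation → Fact → Set
SatFact M (P ⟨ c ⟩at ϱ) = ∀ t → t ∈I ϱ → M P c t

IsModel : Interpretation → Program → Database → Set
IsModel M Π D = All (SatRule M) Π × All (SatFact M) D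

-- P(c)@t ∈ Π(D): the ground atom holds at t in the minimum model of Π and D,
-- i.e. (the minimum model being the intersection of all models) it holds
-- at t in every model of Π and D.
_⟨_⟩at_∈_⟦_⟧ : Pred → List Const → ℚ → Program → Database → Set₁
P ⟨ c ⟩at t ∈ Π ⟦ D ⟧ = (M : Interpretation) → IsModel M Π D → M P c t

toℚ : ℕ → ℚ
toℚ n = + n / 1

{-# OPTIONS --safe #-}
module Submission where

-- Renaming constants that do not occur in Π or D preserves entailment, so it suffices to ground Π over
-- a finite domain.  On a grid fine enough to contain all interval endpoints, the truth of a ground atom
-- at t depends only on whether t is a given grid point, lies in a given gap between neighbouring grid
-- points, or precedes all endpoints of D (where the minimum model is constant in time).  This turns time
-- into ℕ.  As rules only look backwards, derivability is decided section by section, each section being a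
-- finite Datalog saturation over the past.  Bounded windows see a fixed number of recent sections;
-- unbounded ones see in addition only whether an atom held always, or ever, in the older sections.
-- These finitely many bits determine the future, so two sections agreeing on them yield a period.

open import Defs
open import Data.Bool using (Bool; true; false; not; T)
open import Data.Bool.Properties using (T?)
open import Data.Fin as Fin using (Fin)
import Data.Fin.Properties as FinP
open import Data.Integer as ℤ using (+_; -[1+_])
import Data.Integer.Properties as ℤP
open import Data.List as List using (List; []; _∷_; length; map; _++_; concatMap; upTo)
import Data.List.Membership.DecPropositional as DecMembership
open import Data.List.Membership.Propositional using (_∈_; find)
open import Data.List.Membership.Propositional.Properties
  using (∈-map⁺; ∈-map⁻; ∈-concatMap⁺; ∈-concatMap⁻; ∈-upTo⁺; ∈-++⁺ˡ; ∈-++⁺ʳ; ∈-++⁻)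
import Data.List.Properties as ListP
open import Data.List.Relation.Unary.All as All using (All; []; _∷_)
import Data.List.Relation.Unary.All.Properties as AllP
open import Data.List.Relation.Unary.Any as Any using (here; there)
import Data.List.Relation.Unary.Any.Properties as AnyP
open import Data.Nat as ℕ using (ℕ; zero; suc)
import Data.Nat.Coprimality as Coprimality
open import Data.Nat.Induction using (<-rec)
import Data.Nat.Properties as ℕP
open import Data.Nat.Solver using (module +-*-Solver)
open import Data.Product using (Σ; ∃; _×_; _,_; proj₁; proj₂)
import Data.Product.Properties as ×P
open import Data.Rational as Q using (ℚ; mkℚ; 0ℚ; 1ℚ)
import Data.Rational.Properties as ℚP
import Data.Rational.Unnormalised as Qᵘ
import Data.Rational.Unnormalised.Properties as QᵘP
open import Data.Sum as Sum using (_⊎_; inj₁; inj₂)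
open import Data.Unit using (⊤; tt)
open import Function.Base using (id; _∘_)
open import Function.Bundles using (_⇔_; mk⇔; Equivalence)
open import Function.Properties.Equivalence using () renaming (sym to ⇔-sym; trans to ⇔-trans; refl to ⇔-refl)
open import Relation.Binary.Definitions using (DecidableEquality; tri<; tri≈; tri>)
open import Relation.Binary.PropositionalEquality using (_≡_; refl; sym; trans; cong; cong₂; subst; subst₂; module ≡-Reasoning)
open import Relation.Nullary using (Dec; yes; no; does; ¬_; contradiction)
open import Relation.Nullary.Decidable using (_×-dec_; _⊎-dec_; _→-dec_; map′)

-- Entailment quantifies over all models and the theorem over all tuples, while the pigeonhole step
-- needs finitely many decidable statements. The bridge is an interpretation built from derivability
-- on the finite grid: it is a model of `Π` and `D`, so entailed atoms are derivable up to renaming,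
-- and conversely derivable atoms hold in every model. Discretised differences are not
-- single-valued: two gaps can sum to any of three neighbouring cells, two points to one only. The
-- relation between sections is therefore compared under shifts that preserve parity, and parity
-- belongs to the compared state. One unit of time is `k` grid steps, that is `2k` cells; sampling
-- sections at this spacing keeps the parity and makes the period an integer.

module Parity where

  dbl : ℕ → ℕ
  dbl zero    = zero
  dbl (suc i) = suc (suc (dbl i))

  odd : ℕ → Bool
  odd zero          = false
  odd (suc zero)    = true
  odd (suc (suc n)) = odd n

  odd-suc : ∀ n → odd (suc n) ≡ not (odd n)
  odd-suc zero          = refl
  odd-suc (suc zero)    = refl
  odd-suc (suc (suc n)) = odd-suc n

  odd-dbl : ∀ i → odd (dbl i) ≡ false
  odd-dbl zero    = refl
  odd-dbl (suc i) = odd-dbl i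

  odd-cong-+ : ∀ m n e → odd m ≡ odd n → odd (e ℕ.+ m) ≡ odd (e ℕ.+ n)
  odd-cong-+ m n zero    eq = eq
  odd-cong-+ m n (suc e) eq = trans (odd-suc (e ℕ.+ m)) (trans (cong not (odd-cong-+ m n e eq)) (sym (odd-suc (e ℕ.+ n))))

  odd-suc-dbl-cong : ∀ i j → odd (suc (dbl i)) ≡ odd (suc (dbl j))
  odd-suc-dbl-cong i j = odd-cong-+ (dbl i) (dbl j) 1 (trans (odd-dbl i) (sym (odd-dbl j)))

  odd-suc-dbl : ∀ i → T (odd (suc (dbl i)))
  odd-suc-dbl zero    = tt
  odd-suc-dbl (suc i) = odd-suc-dbl i

  parity-view : ∀ n → ∃ λ i → n ≡ dbl i ⊎ n ≡ suc (dbl i)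
  parity-view zero = 0 , inj₁ refl
  parity-view (suc zero) = 0 , inj₂ refl
  parity-view (suc (suc n)) with parity-view n
  ... | i , inj₁ refl = suc i , inj₁ refl
  ... | i , inj₂ refl = suc i , inj₂ refl

  odd⇒suc-dbl : ∀ n → T (odd n) → ∃ λ i → n ≡ suc (dbl i)
  odd⇒suc-dbl (suc zero) _ = 0 , refl
  odd⇒suc-dbl (suc (suc n)) o with odd⇒suc-dbl n o
  ... | i , refl = suc i , refl

  dbl-+ : ∀ i j → dbl (i ℕ.+ j) ≡ dbl i ℕ.+ dbl j
  dbl-+ zero    j = refl
  dbl-+ (suc i) j = cong (λ x → suc (suc x)) (dbl-+ i j)

  dbl-mono-≤ : ∀ {i j} → i ℕ.≤ j → dbl i ℕ.≤ dbl j
  dbl-mono-≤ ℕ.z≤n     = ℕ.z≤n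
  dbl-mono-≤ (ℕ.s≤s p) = ℕ.s≤s (ℕ.s≤s (dbl-mono-≤ p))

  dbl-mono-< : ∀ {i j} → i ℕ.< j → suc (dbl i) ℕ.< dbl j
  dbl-mono-< (ℕ.s≤s p) = ℕ.s≤s (ℕ.s≤s (dbl-mono-≤ p))

  dbl≡+ : ∀ n → dbl n ≡ n ℕ.+ n
  dbl≡+ zero    = refl
  dbl≡+ (suc n) = cong suc (trans (cong suc (dbl≡+ n)) (sym (ℕP.+-suc n n)))

-- Natural numbers inside the rationals

module Naturals where
  open Q using (_+_; _*_; _≤_; _<_)

  -- The denominator 1 is coprime to everything, so normalisation changes nothing; rewriting with
  -- this turns order and products of `ι` into integer arithmetic.
  toℚ≡mkℚ : ∀ n → toℚ n ≡ mkℚ (+ n) 0 (Coprimality.sym (Coprimality.1-coprimeTo n))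
  toℚ≡mkℚ n = ℚP.normalize-coprime (Coprimality.sym (Coprimality.1-coprimeTo n))

  -- An abstract copy of toℚ: unfolding _/_ to a gcd computation makes conversion checking intractable.
  abstract
    ι : ℕ → ℚ
    ι = toℚ

    ι≡toℚ : ∀ n → ι n ≡ toℚ n
    ι≡toℚ n = refl

    ι-+ : ∀ m n → ι (m ℕ.+ n) ≡ ι m + ι n
    ι-+ m n rewrite toℚ≡mkℚ m | toℚ≡mkℚ n =
      cong (Q._/ 1) (cong₂ ℤ._+_ (sym (ℤP.*-identityʳ (+ m))) (sym (ℤP.*-identityʳ (+ n))))

    ι-* : ∀ m n → ι (m ℕ.* n) ≡ ι m * ι n
    ι-* m n rewrite toℚ≡mkℚ m | toℚ≡mkℚ n = cong (Q._/ 1) (ℤP.pos-* m n)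

    ι-0 : ι 0 ≡ 0ℚ
    ι-0 = refl

    ι-mono-≤ : ∀ {m n} → m ℕ.≤ n → ι m ≤ ι n
    ι-mono-≤ {m} {n} m≤n rewrite toℚ≡mkℚ m | toℚ≡mkℚ n =
      Q.*≤* (subst₂ ℤ._≤_ (sym (ℤP.*-identityʳ (+ m))) (sym (ℤP.*-identityʳ (+ n))) (ℤ.+≤+ m≤n))

    ι-mono-< : ∀ {m n} → m ℕ.< n → ι m < ι n
    ι-mono-< {m} {n} m<n rewrite toℚ≡mkℚ m | toℚ≡mkℚ n =
      Q.*<* (subst₂ ℤ._<_ (sym (ℤP.*-identityʳ (+ m))) (sym (ℤP.*-identityʳ (+ n))) (ℤ.+<+ m<n))

    ∣↥ι∣ : ∀ n → ℤ.∣ Q.↥ (ι n) ∣ ≡ n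
    ∣↥ι∣ n rewrite toℚ≡mkℚ n = refl

    ι-archimedean : ∀ v → ∃ λ n → v < ι n
    ι-archimedean v@(mkℚ (+ m) d _) = suc m , lt
      where
      lt : v < ι (suc m)
      lt rewrite toℚ≡mkℚ (suc m) = Q.*<* (subst₂ ℤ._<_ (sym (ℤP.*-identityʳ (+ m))) (ℤP.pos-* (suc m) (suc d))
        (ℤ.+<+ (ℕP.m≤m*n (suc m) (suc d))))
    ι-archimedean v@(mkℚ -[1+ m ] d _) = 0 , ℚP.negative⁻¹ v

  0≤ι : ∀ n → 0ℚ ≤ ι n
  0≤ι n = subst (_≤ ι n) ι-0 (ι-mono-≤ ℕ.z≤n)

module Differences where
  open Q using (_+_; _-_; _≤_; _<_)

  a+[b-a]≡b : ∀ a b → a + (b - a) ≡ b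
  a+[b-a]≡b a b = begin
    a + (b - a)        ≡⟨ ℚP.+-comm a (b - a) ⟩
    b - a + a          ≡⟨ ℚP.+-assoc b (Q.- a) a ⟩
    b + (Q.- a + a)    ≡⟨ cong (λ x → b + x) (ℚP.+-inverseˡ a) ⟩
    b + 0ℚ             ≡⟨ ℚP.+-identityʳ b ⟩
    b                  ∎
    where open ≡-Reasoning

  [a+b]-b≡a : ∀ a b → a + b - b ≡ a
  [a+b]-b≡a a b = trans (ℚP.+-assoc a b (Q.- b)) (trans (cong (λ x → a + x) (ℚP.+-inverseʳ b)) (ℚP.+-identityʳ a))

  b-[b-a]≡a : ∀ a b → b - (b - a) ≡ a
  b-[b-a]≡a a b = trans (cong (λ x → x - (b - a)) (sym (a+[b-a]≡b a b))) ([a+b]-b≡a a (b - a))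

  ≤⇒0≤- : ∀ {a b} → a ≤ b → 0ℚ ≤ b - a
  ≤⇒0≤- {a} {b} a≤b = subst (_≤ b - a) (ℚP.+-inverseʳ a) (ℚP.+-monoˡ-≤ (Q.- a) a≤b)

  0≤-⇒≤ : ∀ {a b} → 0ℚ ≤ b - a → a ≤ b
  0≤-⇒≤ {a} {b} p = subst₂ _≤_ (ℚP.+-identityʳ a) (a+[b-a]≡b a b) (ℚP.+-monoʳ-≤ a p)

  +<⇒<- : ∀ {a b c} → a + b < c → a < c - b
  +<⇒<- {a} {b} {c} p = subst (_< c - b) ([a+b]-b≡a a b) (ℚP.+-monoˡ-< (Q.- b) p)

  <+⇒-< : ∀ {a b c} → c < a + b → c - b < a
  <+⇒-< {a} {b} {c} p = subst (c - b <_) ([a+b]-b≡a a b) (ℚP.+-monoˡ-< (Q.- b) p)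

  <-⇒+< : ∀ {a b c} → a < c - b → a + b < c
  <-⇒+< {a} {b} {c} p = subst (a + b <_) (trans (ℚP.+-comm (c - b) b) (a+[b-a]≡b b c)) (ℚP.+-monoˡ-< b p)

  -<⇒<+ : ∀ {a b c} → c - b < a → c < a + b
  -<⇒<+ {a} {b} {c} p = subst (_< a + b) (trans (ℚP.+-comm (c - b) b) (a+[b-a]≡b b c)) (ℚP.+-monoˡ-< b p)

  <-flip : ∀ {a b c} → a < c - b → b < c - a
  <-flip {a} {b} {c} p = +<⇒<- (subst (_< c) (ℚP.+-comm a b) (<-⇒+< p))

  -<flip : ∀ {a b c} → c - b < a → c - a < b
  -<flip {a} {b} {c} p = <+⇒-< (subst (c <_) (ℚP.+-comm a b) (-<⇒<+ p))

  -- By density between the larger lower bound and the smaller upper bound. Four constraints arise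
  -- because a point and its distance to a given `u` must both fall into prescribed gaps.
  interpolate : ∀ {a b c d} → a < c → a < d → b < c → b < d → ∃ λ v → a < v × b < v × v < c × v < d
  interpolate {a} {b} {c} {d} ac ad bc bd with ℚP.≤-total a b | ℚP.≤-total c d
  ... | inj₁ a≤b | inj₁ c≤d = let v , l , r = ℚP.<-dense bc in v , ℚP.≤-<-trans a≤b l , l , r , ℚP.<-≤-trans r c≤d
  ... | inj₁ a≤b | inj₂ d≤c = let v , l , r = ℚP.<-dense bd in v , ℚP.≤-<-trans a≤b l , l , ℚP.<-≤-trans r d≤c , r
  ... | inj₂ b≤a | inj₁ c≤d = let v , l , r = ℚP.<-dense ac in v , l , ℚP.≤-<-trans b≤a l , r , ℚP.<-≤-trans r c≤d
  ... | inj₂ b≤a | inj₂ d≤c = let v , l , r = ℚP.<-dense ad in v , l , ℚP.≤-<-trans b≤a l , ℚP.<-≤-trans r d≤c , r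

-- Points and gaps of the integer grid, and their sums and differences

module Cells where
  open Differences
  open Parity
  open Naturals
  open Q using (_+_; _-_; _*_; _≤_; _<_)

  -- The nonnegative rationals are cut into the points i (cell 2i) and the gaps (i , i+1) (cell 2i+1).
  data Cell : ℕ → ℚ → Set where
    point : ∀ i {v} → v ≡ ι i → Cell (dbl i) v
    gap   : ∀ i {v} → ι i < v → v < ι (suc i) → Cell (suc (dbl i)) v

  cell-below : ∀ N {v} → 0ℚ ≤ v → v < ι N → ∃ λ n → Cell n v
  cell-below zero {v} 0≤v v<0 = contradiction (ℚP.≤-<-trans 0≤v (subst (v <_) ι-0 v<0)) (ℚP.<-irrefl refl)
  cell-below (suc N) {v} 0≤v v<N with ℚP.<-cmp v (ι N)
  ... | tri< lt _ _ = cell-below N 0≤v lt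
  ... | tri≈ _ eq _ = dbl N , point N eq
  ... | tri> _ _ gt = suc (dbl N) , gap N gt v<N

  cell-of : ∀ {v} → 0ℚ ≤ v → ∃ λ n → Cell n v
  cell-of {v} 0≤v = let N , lt = ι-archimedean v in cell-below N 0≤v lt

  cell-nonneg : ∀ {n v} → Cell n v → 0ℚ ≤ v
  cell-nonneg (point i refl) = 0≤ι i
  cell-nonneg (gap i lt _)   = ℚP.<⇒≤ (ℚP.≤-<-trans (0≤ι i) lt)

  data Comparison (m : ℕ) (v : ℚ) (E : ℕ) : Set where
    below : v < ι E → m ℕ.< dbl E → Comparison m v E
    equal : v ≡ ι E → m ≡ dbl E → Comparison m v E
    above : ι E < v → dbl E ℕ.< m → Comparison m v E

  -- A cell never straddles a grid point, so indices and rationals compare alike; returning both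
  -- verdicts together lets order facts pass in either direction.
  cell-compare : ∀ {m v} → Cell m v → ∀ E → Comparison m v E
  cell-compare (point i refl) E with ℕP.<-cmp i E
  ... | tri< lt _ _   = below (ι-mono-< lt) (ℕP.<-trans (ℕP.n<1+n _) (dbl-mono-< lt))
  ... | tri≈ _ refl _ = equal refl refl
  ... | tri> _ _ gt   = above (ι-mono-< gt) (ℕP.<-trans (ℕP.n<1+n _) (dbl-mono-< gt))
  cell-compare (gap i l u) E with i ℕP.<? E
  ... | yes i<E = below (ℚP.<-≤-trans u (ι-mono-≤ i<E)) (dbl-mono-< i<E)
  ... | no  i≮E = above (ℚP.≤-<-trans (ι-mono-≤ E≤i) l) (ℕ.s≤s (dbl-mono-≤ E≤i))
    where E≤i = ℕP.≮⇒≥ i≮E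

  cell-pos : ∀ {n u} → Cell (suc n) u → 0ℚ < u
  cell-pos {u = u} c with cell-compare c 0
  ... | above lt _ = subst (_< u) ι-0 lt

  cell-zero : ∀ {u} → Cell 0 u → u ≡ 0ℚ
  cell-zero c with cell-compare c 0
  ... | equal eq _ = trans eq ι-0

  cell-mono : ∀ {m n u v} → Cell m u → Cell n v → u ≤ v → m ℕ.≤ n
  cell-mono (point i refl) c u≤v with cell-compare c i
  ... | below lt _   = contradiction (ℚP.≤-<-trans u≤v lt) (ℚP.<-irrefl refl)
  ... | equal _ refl = ℕP.≤-refl
  ... | above _ lt   = ℕP.<⇒≤ lt
  cell-mono (gap i l _) c u≤v with cell-compare c i
  ... | below lt _   = contradiction (ℚP.<-trans (ℚP.<-≤-trans l u≤v) lt) (ℚP.<-irrefl refl)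
  ... | equal refl _ = contradiction (ℚP.<-≤-trans l u≤v) (ℚP.<-irrefl refl)
  ... | above _ lt   = lt

  cell-unique : ∀ {m n v} → Cell m v → Cell n v → m ≡ n
  cell-unique c c′ = ℕP.≤-antisym (cell-mono c c′ ℚP.≤-refl) (cell-mono c′ c ℚP.≤-refl)

  -- The cells n in which the sum of a point of cell d and a point of cell m can lie.
  SumCell : ℕ → ℕ → ℕ → Set
  SumCell d m n = d ℕ.+ m ≡ n ⊎ T (odd m) × T (odd d) × (suc d ℕ.+ m ≡ n ⊎ d ℕ.+ m ≡ suc n)

  sum-≤ : ∀ d {m n} → SumCell d m n → m ℕ.≤ n
  sum-≤ d (inj₁ refl)                            = ℕP.m≤n+m _ d
  sum-≤ d (inj₂ (_ , _ , inj₁ refl))             = ℕP.m≤n+m _ (suc d)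
  -- An odd `d` is nonzero, and its successor absorbs the one on the right.
  sum-≤ (suc d) {m} (inj₂ (_ , _ , inj₂ eq))     = subst (m ℕ.≤_) (ℕP.suc-injective eq) (ℕP.m≤n+m m d)

  cell-translate : ∀ i {m v} → Cell m v → Cell (dbl i ℕ.+ m) (ι i + v)
  cell-translate i (point j refl) = subst (λ n → Cell n (ι i + ι j)) (dbl-+ i j) (point (i ℕ.+ j) (sym (ι-+ i j)))
  cell-translate i (gap j {v} l r) = subst (λ n → Cell n (ι i + v)) (trans (cong suc (dbl-+ i j)) (sym (ℕP.+-suc _ _)))
    (gap (i ℕ.+ j)
      (subst (_< ι i + v) (sym (ι-+ i j)) (ℚP.+-monoʳ-< (ι i) l))
      (subst (ι i + v <_) (trans (sym (ι-+ i (suc j))) (cong ι (ℕP.+-suc i j))) (ℚP.+-monoʳ-< (ι i) r)))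

  -- Two gaps sum to an open interval of length two: a gap, the grid point `i + j + 1` and the next
  -- gap. As soon as one summand is a grid point, the indices just add.
  cell-sum : ∀ {d m u v} → Cell d u → Cell m v → ∃ λ n → Cell n (u + v) × SumCell d m n
  cell-sum (point i refl) c = _ , cell-translate i c , inj₁ refl
  cell-sum {v = v} (gap i {u} l r) (point j refl) = _ ,
    gap (i ℕ.+ j)
      (subst (_< u + v) (sym (ι-+ i j)) (ℚP.+-monoˡ-< v l))
      (subst (u + v <_) (sym (ι-+ (suc i) j)) (ℚP.+-monoˡ-< v r)) ,
    inj₁ (cong suc (sym (dbl-+ i j)))
  cell-sum {u = u} {v} (gap i l r) (gap j l′ r′) with ℚP.<-cmp (u + v) (ι (suc (i ℕ.+ j)))
  ... | tri< lt _ _ = _ , gap (i ℕ.+ j) (subst (_< u + v) (sym (ι-+ i j)) (ℚP.+-mono-< l l′)) lt ,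
    inj₂ (odd-suc-dbl j , odd-suc-dbl i , inj₂ (cong suc (trans (ℕP.+-suc _ _) (cong suc (sym (dbl-+ i j))))))
  ... | tri≈ _ eq _ = _ , point (suc (i ℕ.+ j)) eq ,
    inj₁ (cong suc (trans (ℕP.+-suc _ _) (cong suc (sym (dbl-+ i j)))))
  ... | tri> _ _ gt = _ , gap (suc (i ℕ.+ j)) gt
      (subst (u + v <_) (trans (sym (ι-+ (suc i) (suc j))) (cong ι (cong suc (ℕP.+-suc i j)))) (ℚP.+-mono-< r r′)) ,
    inj₂ (odd-suc-dbl j , odd-suc-dbl i , inj₁ (cong suc (cong suc (trans (ℕP.+-suc _ _) (cong suc (sym (dbl-+ i j)))))))

  -- No subtraction of indices: `u - ι δ` has some cell, and translating it back by `δ` must give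
  -- the cell of `u`.
  cell-shift : ∀ δ {n u} → Cell (dbl δ ℕ.+ n) u → Cell n (u - ι δ)
  cell-shift δ {n} {u} c with cell-of (≤⇒0≤- δ≤u)
    where
    δ≤u : ι δ ≤ u
    δ≤u with cell-compare c δ
    ... | below _ lt = contradiction lt (ℕP.≤⇒≯ (ℕP.m≤m+n _ _))
    ... | equal eq _ = ℚP.≤-reflexive (sym eq)
    ... | above gt _ = ℚP.<⇒≤ gt
  ... | m , c′ = subst (λ x → Cell x _)
    (ℕP.+-cancelˡ-≡ (dbl δ) _ _
      (cell-unique (subst (Cell (dbl δ ℕ.+ m)) (a+[b-a]≡b (ι δ) u) (cell-translate δ c′)) c)) c′

  -- Section 0 collects all u ≤ 0: scaled interval endpoints are positive and cannot separate these points.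
  Sec : ℕ → ℚ → Set
  Sec zero    u = u ≤ 0ℚ
  Sec (suc n) u = Cell (suc n) u

  sec-of : ∀ u → ∃ λ n → Sec n u
  sec-of u with u ℚP.≤? 0ℚ
  ... | yes u≤0 = 0 , u≤0
  ... | no  u≰0 with cell-of (ℚP.<⇒≤ (ℚP.≰⇒> u≰0))
  ... | zero  , c = contradiction (ℚP.≤-reflexive (cell-zero c)) u≰0
  ... | suc n , c = suc n , c

  cell⇒sec : ∀ {n u} → Cell n u → Sec n u
  cell⇒sec {zero} c  = ℚP.≤-reflexive (cell-zero c)
  cell⇒sec {suc n} c = c

  -- The cells d in which u - v ≥ 0 can lie for u in section n and v in section m; by sec-split, every
  -- such d is attained for each u, so the choice of u in its section is immaterial.
  Diff : ℕ → ℕ → ℕ → Set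
  Diff n zero    d = n ℕ.≤ d
  Diff n (suc m) d = SumCell d (suc m) n

  sec-diff : ∀ {n m d u v} → Sec n u → Sec m v → Cell d (u - v) → Diff n m d
  sec-diff {zero} {zero} _ _ _ = ℕ.z≤n
  sec-diff {suc n} {zero} {u = u} {v} c v≤0 c′ = cell-mono c c′
    (subst (_≤ u - v) (ℚP.+-identityʳ u) (ℚP.+-monoʳ-≤ u (ℚP.neg-antimono-≤ v≤0)))
  sec-diff {zero} {suc m} u≤0 c c′ = contradiction
    (ℚP.<-≤-trans (cell-pos c) (ℚP.≤-trans (0≤-⇒≤ (cell-nonneg c′)) u≤0)) (ℚP.<-irrefl refl)
  sec-diff {suc n} {suc m} {u = u} {v} c c′ c″ with cell-sum c″ c′
  ... | n′ , s , p with cell-unique c (subst (Cell n′) (trans (ℚP.+-comm (u - v) v) (a+[b-a]≡b v u)) s)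
  ... | refl = p

  -- The point `v` has to lie both in `(j , j+1)` and in `(u-i-1 , u-i)`; the hypotheses say exactly
  -- that these intervals overlap.
  split-gaps : ∀ i j {u} → ι (i ℕ.+ j) < u → u < ι (suc (suc (i ℕ.+ j))) →
               ∃ λ v → Cell (suc (dbl j)) v × Cell (suc (dbl i)) (u - v)
  split-gaps i j {u} l r with interpolate
    (ι-mono-< (ℕP.n<1+n j))
    (+<⇒<- {b = ι i} (subst (_< u) (trans (cong ι (ℕP.+-comm i j)) (ι-+ j i)) l))
    (<+⇒-< {b = ι (suc i)}
      (subst (u <_) (trans (cong (λ x → ι (suc x)) (trans (cong suc (ℕP.+-comm i j)) (sym (ℕP.+-suc j i)))) (ι-+ (suc j) (suc i))) r))
    (ℚP.+-monoʳ-< u (ℚP.neg-antimono-< (ι-mono-< (ℕP.n<1+n i))))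
  ... | v , j<v , u-i<v , v<j , v<u-i = v , gap j j<v v<j , gap i (<-flip {c = u} v<u-i) (-<flip {c = u} u-i<v)

  cell-bounds : ∀ {n u} i → Cell n u → dbl i ℕ.< n → n ℕ.< dbl (suc (suc i)) → ι i < u × u < ι (suc (suc i))
  cell-bounds i c l r with cell-compare c i | cell-compare c (suc (suc i))
  ... | below _ p | _ = contradiction p (ℕP.<-asym l)
  ... | equal _ p | _ = contradiction (sym p) (ℕP.<⇒≢ l)
  ... | above _ _ | equal _ p = contradiction p (ℕP.<⇒≢ r)
  ... | above _ _ | above _ p = contradiction p (ℕP.<-asym r)
  ... | above p _ | below q _ = p , q

  split-odd : ∀ i j {n u} → Cell n u → dbl (i ℕ.+ j) ℕ.< n → n ℕ.< dbl (suc (suc (i ℕ.+ j))) →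
              ∃ λ v → Cell (suc (dbl j)) v × Cell (suc (dbl i)) (u - v)
  split-odd i j c l r = let p , q = cell-bounds (i ℕ.+ j) c l r in split-gaps i j p q

  odd-sum : ∀ i j → suc (dbl i) ℕ.+ suc (dbl j) ≡ suc (suc (dbl (i ℕ.+ j)))
  odd-sum i j = cong suc (trans (ℕP.+-suc _ _) (cong suc (sym (dbl-+ i j))))

  -- Converse of `cell-sum` for a prescribed sum `u`. A summand that is a grid point is simply
  -- subtracted; for two gaps all three admissible cells lie strictly between `i + j` and
  -- `i + j + 2`, which is all that `split-gaps` asks for.
  cell-split : ∀ {d m n u} → Cell n u → SumCell d m n → ∃ λ v → Cell m v × Cell d (u - v)
  cell-split {d} {m} {u = u} c (inj₁ refl) with parity-view d | parity-view m
  ... | i , inj₁ refl | _ = u - ι i , cell-shift i c , point i (b-[b-a]≡a (ι i) u)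
  ... | i , inj₂ refl | j , inj₁ refl = ι j , point j refl ,
    cell-shift j (subst (λ n → Cell n u) (ℕP.+-comm (suc (dbl i)) (dbl j)) c)
  ... | i , inj₂ refl | j , inj₂ refl = split-odd i j c
    (subst (dbl (i ℕ.+ j) ℕ.<_) (sym (odd-sum i j)) (ℕP.m<n⇒m<1+n (ℕP.n<1+n _)))
    (subst (ℕ._< dbl (suc (suc (i ℕ.+ j)))) (sym (odd-sum i j)) (ℕP.m<n⇒m<1+n (ℕP.n<1+n _)))
  cell-split {d} {m} c (inj₂ (om , od , eq)) with odd⇒suc-dbl d od | odd⇒suc-dbl m om
  cell-split c (inj₂ (_ , _ , inj₁ refl)) | i , refl | j , refl = split-odd i j c
    (subst (λ x → dbl (i ℕ.+ j) ℕ.< suc x) (sym (odd-sum i j)) (ℕP.m<n⇒m<1+n (ℕP.m<n⇒m<1+n (ℕP.n<1+n _))))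
    (subst (λ x → suc x ℕ.< dbl (suc (suc (i ℕ.+ j)))) (sym (odd-sum i j)) (ℕP.n<1+n _))
  cell-split c (inj₂ (_ , _ , inj₂ eq)) | i , refl | j , refl with trans (sym (odd-sum i j)) eq
  ... | refl = split-odd i j c (ℕP.n<1+n _) (ℕP.m<n⇒m<1+n (ℕP.m<n⇒m<1+n (ℕP.n<1+n _)))

  cell-inhabited : ∀ n → ∃ λ v → Cell n v
  cell-inhabited n with parity-view n
  ... | i , inj₁ refl = ι i , point i refl
  ... | i , inj₂ refl = let v , l , r = ℚP.<-dense (ι-mono-< (ℕP.n<1+n i)) in v , gap i l r

  sec-split : ∀ {n m d u} → Sec n u → Diff n m d → ∃ λ v → Sec m v × Cell d (u - v)
  sec-split {n} {zero} {d} {u} s n≤d with cell-inhabited d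
  ... | w , c with u ℚP.≤? w
  ... | yes u≤w = u - w , subst (u - w ≤_) (ℚP.+-inverseʳ w) (ℚP.+-monoˡ-≤ (Q.- w) u≤w) ,
    subst (Cell d) (sym (b-[b-a]≡a w u)) c
  sec-split {zero} {zero} {d} {u} u≤0 n≤d | w , c | no u≰w =
    contradiction (ℚP.≤-trans u≤0 (cell-nonneg c)) u≰w
  -- Now `w < u`, so the cell of `w` cannot come after that of `u`; with `n≤d` the two cells
  -- coincide, and `u` itself is a distance in cell `d`, measured from 0.
  sec-split {suc n} {zero} {d} {u} s n≤d | w , c | no u≰w = 0ℚ , ℚP.≤-refl ,
    subst₂ Cell (ℕP.≤-antisym n≤d (cell-mono c s (ℚP.<⇒≤ (ℚP.≰⇒> u≰w)))) (sym (ℚP.+-identityʳ u)) s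
  sec-split {zero} {suc m} {d} s p = contradiction (sum-≤ d p) λ ()
  sec-split {suc n} {suc m} s p = cell-split s p

  sec-unique : ∀ {m n u} → Sec m u → Sec n u → m ≡ n
  sec-unique {zero}  {zero}  _ _ = refl
  sec-unique {zero}  {suc _} p c = contradiction (ℚP.<-≤-trans (cell-pos c) p) (ℚP.<-irrefl refl)
  sec-unique {suc _} {zero}  c p = contradiction (ℚP.<-≤-trans (cell-pos c) p) (ℚP.<-irrefl refl)
  sec-unique {suc _} {suc _} c c′ = cell-unique c c′

  sec-compare : ∀ {m u} → Sec m u → ∀ {E} → 1 ℕ.≤ E → Comparison m u E
  sec-compare {zero} u≤0 {suc E} _ = below (ℚP.≤-<-trans u≤0 (subst (_< ι (suc E)) ι-0 (ι-mono-< (ℕ.s≤s ℕ.z≤n)))) (ℕ.s≤s ℕ.z≤n)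
  sec-compare {suc m} c {E} _ = cell-compare c E

  diff-≤ : ∀ {n} m {d} → Diff n m d → m ℕ.≤ n
  diff-≤ zero    _ = ℕ.z≤n
  diff-≤ (suc m) p = sum-≤ _ p

  -- Apart from the parity of `b`, `SumCell` sees only the difference of the two indices.
  sum-shift : ∀ {d e b b′} → odd b ≡ odd b′ → SumCell d b (b ℕ.+ e) → SumCell d b′ (b′ ℕ.+ e)
  sum-shift {d} {e} {b} {b′} par (inj₁ eq) =
    inj₁ (trans (ℕP.+-comm d b′) (cong (b′ ℕ.+_) (ℕP.+-cancelˡ-≡ b d e (trans (ℕP.+-comm b d) eq))))
  sum-shift {d} {e} {b} {b′} par (inj₂ (ob , od , inj₁ eq)) = inj₂ (subst T par ob , od ,
    inj₁ (trans (ℕP.+-comm (suc d) b′) (cong (b′ ℕ.+_) (ℕP.+-cancelˡ-≡ b (suc d) e (trans (ℕP.+-comm b (suc d)) eq)))))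
  sum-shift {d} {e} {b} {b′} par (inj₂ (ob , od , inj₂ eq)) = inj₂ (subst T par ob , od ,
    inj₂ (trans (ℕP.+-comm d b′) (trans (cong (b′ ℕ.+_)
      (ℕP.+-cancelˡ-≡ b d (suc e) (trans (ℕP.+-comm b d) (trans eq (sym (ℕP.+-suc b e)))))) (ℕP.+-suc b′ e))))

  -- The strict inequality leaves one unit of slack, which pays for the rounding in `SumCell`.
  diff-far : ∀ {n} m {d c} → m ℕ.+ c ℕ.< n → Diff n m d → c ℕ.≤ d
  diff-far zero    lt p = ℕP.≤-trans (ℕP.<⇒≤ lt) p
  diff-far (suc m) {d} {c} lt (inj₁ refl) =
    ℕP.<⇒≤ (ℕP.+-cancelʳ-< (suc m) c d (subst (ℕ._< d ℕ.+ suc m) (ℕP.+-comm (suc m) c) lt))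
  diff-far (suc m) {d} {c} lt (inj₂ (_ , _ , inj₁ refl)) =
    ℕP.≤-pred (ℕP.+-cancelʳ-< (suc m) c (suc d) (subst (ℕ._< suc d ℕ.+ suc m) (ℕP.+-comm (suc m) c) lt))
  diff-far (suc m) {d} {c} lt (inj₂ (_ , _ , inj₂ eq)) =
    ℕP.<⇒≤ (ℕP.+-cancelʳ-< (suc m) c d (subst₂ ℕ._<_ (ℕP.+-comm (suc m) c) (sym eq) (ℕP.m<n⇒m<1+n lt)))

  diff-∸ : ∀ {n} m → m ℕ.≤ n → Diff n m (n ℕ.∸ m)
  diff-∸ zero    _ = ℕP.≤-refl
  diff-∸ (suc m) p = inj₁ (ℕP.m∸n+n≡m p)

  sum? : ∀ d m n → Dec (SumCell d m n)
  sum? d m n = (d ℕ.+ m ℕP.≟ n) ⊎-dec (T? (odd m) ×-dec (T? (odd d) ×-dec ((suc d ℕ.+ m ℕP.≟ n) ⊎-dec (d ℕ.+ m ℕP.≟ suc n))))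

  diff? : ∀ n m d → Dec (Diff n m d)
  diff? n zero    d = n ℕP.≤? d
  diff? n (suc m) d = sum? d (suc m) n

open Parity
open Naturals
open Differences
open Cells

-- Rescaled time: intervals and temporal windows in terms of sections

module Timeline (k Z : ℕ) (0<k : 0 ℕ.< k) where

  open Q using (_+_; _-_; _*_; _≤_; _<_)

  ιk>0 : 0ℚ < ι k
  ιk>0 = subst (_< ι k) ι-0 (ι-mono-< 0<k)

  instance
    ιk-pos : Q.Positive (ι k)
    ιk-pos = Q.positive ιk>0

    ιk-nonNeg : Q.NonNegative (ι k)
    ιk-nonNeg = ℚP.pos⇒nonNeg (ι k)

    ιk-nonZero : Q.NonZero (ι k)
    ιk-nonZero = ℚP.pos⇒nonZero (ι k)

  -- k clears the denominators of all interval endpoints, and the translation by Z makes them positive.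
  scale : ℚ → ℚ
  scale t = ι k * t + ι Z

  unscale : ℚ → ℚ
  unscale u = Q.1/ ι k * (u - ι Z)

  scale-unscale : ∀ u → scale (unscale u) ≡ u
  scale-unscale u = begin
    ι k * (Q.1/ ι k * (u - ι Z)) + ι Z   ≡⟨ cong (λ x → x + ι Z) (sym (ℚP.*-assoc (ι k) (Q.1/ ι k) (u - ι Z))) ⟩
    ι k * Q.1/ ι k * (u - ι Z) + ι Z     ≡⟨ cong (λ x → x * (u - ι Z) + ι Z) (ℚP.*-inverseʳ (ι k)) ⟩
    1ℚ * (u - ι Z) + ι Z                 ≡⟨ cong (λ x → x + ι Z) (ℚP.*-identityˡ (u - ι Z)) ⟩
    (u - ι Z) + ι Z                      ≡⟨ ℚP.+-comm (u - ι Z) (ι Z) ⟩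
    ι Z + (u - ι Z)                      ≡⟨ a+[b-a]≡b (ι Z) u ⟩
    u                                    ∎
    where open ≡-Reasoning

  scale-+ : ∀ t s → scale (t + s) ≡ scale t + ι k * s
  scale-+ t s = begin
    ι k * (t + s) + ι Z          ≡⟨ cong (λ x → x + ι Z) (ℚP.*-distribˡ-+ (ι k) t s) ⟩
    ι k * t + ι k * s + ι Z      ≡⟨ ℚP.+-assoc (ι k * t) (ι k * s) (ι Z) ⟩
    ι k * t + (ι k * s + ι Z)    ≡⟨ cong (λ x → ι k * t + x) (ℚP.+-comm (ι k * s) (ι Z)) ⟩
    ι k * t + (ι Z + ι k * s)    ≡⟨ sym (ℚP.+-assoc (ι k * t) (ι Z) (ι k * s)) ⟩
    scale t + ι k * s            ∎
    where open ≡-Reasoning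

  scale-diff : ∀ t s → scale t - scale s ≡ ι k * (t - s)
  scale-diff t s = begin
    scale t - scale s                        ≡⟨ cong (λ x → scale x - scale s) (sym (a+[b-a]≡b s t)) ⟩
    scale (s + (t - s)) - scale s            ≡⟨ cong (λ x → x - scale s) (scale-+ s (t - s)) ⟩
    scale s + ι k * (t - s) - scale s        ≡⟨ cong (λ x → x - scale s) (ℚP.+-comm (scale s) (ι k * (t - s))) ⟩
    ι k * (t - s) + scale s - scale s        ≡⟨ [a+b]-b≡a (ι k * (t - s)) (scale s) ⟩
    ι k * (t - s)                            ∎
    where open ≡-Reasoning

  scale-of-diff : ∀ t s → scale (t - s) ≡ ι Z + (scale t - scale s)
  scale-of-diff t s = trans (cong (λ x → x + ι Z) (sym (scale-diff t s))) (ℚP.+-comm (scale t - scale s) (ι Z))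

  scale-mono-≤ : ∀ {t s} → t ≤ s → scale t ≤ scale s
  scale-mono-≤ t≤s = ℚP.+-monoˡ-≤ (ι Z) (ℚP.*-monoˡ-≤-nonNeg (ι k) t≤s)

  scale-mono-< : ∀ {t s} → t < s → scale t < scale s
  scale-mono-< t<s = ℚP.+-monoˡ-< (ι Z) (ℚP.*-monoʳ-<-pos (ι k) t<s)

  scale-cancel-≤ : ∀ {t s} → scale t ≤ scale s → t ≤ s
  scale-cancel-≤ {t} {s} p = ℚP.≮⇒≥ λ s<t → ℚP.<-irrefl refl (ℚP.<-≤-trans (scale-mono-< s<t) p)

  scale-cancel-< : ∀ {t s} → scale t < scale s → t < s
  scale-cancel-< {t} {s} p = ℚP.≰⇒> λ s≤t → ℚP.<-irrefl refl (ℚP.<-≤-trans p (scale-mono-≤ s≤t))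

  -- A total function, so that `In` and `Window` can be defined before endpoints are known to be
  -- grid points. Where `scale q` is a natural number, its numerator is that number.
  grid : ℚ → ℕ
  grid q = ℤ.∣ Q.↥ (scale q) ∣

  -- `lower` keeps endpoints out of section 0, inside which times cannot be told apart; `upper` is
  -- the bound behind `horizon`.
  record GridPoint (q : ℚ) : Set where
    field
      scaled : scale q ≡ ι (grid q)
      lower  : 1 ℕ.≤ grid q
      upper  : grid q ℕ.≤ dbl Z

  gridPoint : ∀ {q E} → scale q ≡ ι E → 1 ℕ.≤ E → E ℕ.≤ dbl Z → GridPoint q
  gridPoint {q} {E} eq l u = record
    { scaled = trans eq (cong ι (sym e))
    ; lower  = subst (1 ℕ.≤_) (sym e) l
    ; upper  = subst (ℕ._≤ dbl Z) (sym e) u }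
    where e : grid q ≡ E
          e = trans (cong (λ x → ℤ.∣ Q.↥ x ∣) eq) (∣↥ι∣ E)

  GridL : LBound → Set
  GridL -∞          = ⊤
  GridL (closedL q) = GridPoint q
  GridL (openL q)   = GridPoint q

  GridU : UBound → Set
  GridU +∞          = ⊤
  GridU (closedU q) = GridPoint q
  GridU (openU q)   = GridPoint q

  Grid : Interval → Set
  Grid ⟨ l , u ⟩ = GridL l × GridU u

  InL : LBound → ℕ → Set
  InL -∞          m = ⊤
  InL (closedL q) m = dbl (grid q) ℕ.≤ m
  InL (openL q)   m = dbl (grid q) ℕ.< m

  InU : UBound → ℕ → Set
  InU +∞          m = ⊤
  InU (closedU q) m = m ℕ.≤ dbl (grid q)
  InU (openU q)   m = m ℕ.< dbl (grid q)

  In : Interval → ℕ → Set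
  In ⟨ l , u ⟩ m = InL l m × InU u m

  InL? : ∀ l m → Dec (InL l m)
  InL? -∞          m = yes tt
  InL? (closedL q) m = dbl (grid q) ℕP.≤? m
  InL? (openL q)   m = dbl (grid q) ℕP.<? m

  InU? : ∀ u m → Dec (InU u m)
  InU? +∞          m = yes tt
  InU? (closedU q) m = m ℕP.≤? dbl (grid q)
  InU? (openU q)   m = m ℕP.<? dbl (grid q)

  In? : ∀ I m → Dec (In I m)
  In? ⟨ l , u ⟩ m = InL? l m ×-dec InU? u m

  data Position (m : ℕ) (t q : ℚ) : Set where
    below : t < q → m ℕ.< dbl (grid q) → Position m t q
    equal : t ≡ q → m ≡ dbl (grid q) → Position m t q
    above : q < t → dbl (grid q) ℕ.< m → Position m t q

  position : ∀ {m t q} → Sec m (scale t) → GridPoint q → Position m t q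
  position {m} {t} {q} s g with sec-compare s (GridPoint.lower g)
  ... | below p m< = below (scale-cancel-< (subst (scale t <_) (sym (GridPoint.scaled g)) p)) m<
  ... | equal p m≡ = let e = trans p (sym (GridPoint.scaled g)) in
    equal (ℚP.≤-antisym (scale-cancel-≤ (ℚP.≤-reflexive e)) (scale-cancel-≤ (ℚP.≤-reflexive (sym e)))) m≡
  ... | above p m> = above (scale-cancel-< (subst (_< scale t) (sym (GridPoint.scaled g)) p)) m>

  inL⇔ : ∀ {l m t} → GridL l → Sec m (scale t) → aboveL l t ⇔ InL l m
  inL⇔ { -∞ } _ _ = mk⇔ (λ x → x) (λ x → x)
  inL⇔ {closedL q} g s with position s g
  ... | below t< m<     = mk⇔ (λ q≤t → contradiction (ℚP.<-≤-trans t< q≤t) (ℚP.<-irrefl refl)) (λ ≤m → contradiction m< (ℕP.≤⇒≯ ≤m))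
  ... | equal refl refl = mk⇔ (λ _ → ℕP.≤-refl) (λ _ → ℚP.≤-refl)
  ... | above t> m>     = mk⇔ (λ _ → ℕP.<⇒≤ m>) (λ _ → ℚP.<⇒≤ t>)
  inL⇔ {openL q} g s with position s g
  ... | below t< m<     = mk⇔ (λ q<t → contradiction q<t (ℚP.<-asym t<)) (λ <m → contradiction m< (ℕP.<-asym <m))
  ... | equal refl refl = mk⇔ (λ p → contradiction p (ℚP.<-irrefl refl)) (λ p → contradiction p (ℕP.<-irrefl refl))
  ... | above t> m>     = mk⇔ (λ _ → m>) (λ _ → t>)

  inU⇔ : ∀ {u m t} → GridU u → Sec m (scale t) → belowU u t ⇔ InU u m
  inU⇔ { +∞ } _ _ = mk⇔ (λ x → x) (λ x → x)
  inU⇔ {closedU q} g s with position s g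
  ... | above t> m>     = mk⇔ (λ t≤q → contradiction (ℚP.<-≤-trans t> t≤q) (ℚP.<-irrefl refl)) (λ m≤ → contradiction m> (ℕP.≤⇒≯ m≤))
  ... | equal refl refl = mk⇔ (λ _ → ℕP.≤-refl) (λ _ → ℚP.≤-refl)
  ... | below t< m<     = mk⇔ (λ _ → ℕP.<⇒≤ m<) (λ _ → ℚP.<⇒≤ t<)
  inU⇔ {openU q} g s with position s g
  ... | above t> m>     = mk⇔ (λ t<q → contradiction t<q (ℚP.<-asym t>)) (λ m< → contradiction m> (ℕP.<-asym m<))
  ... | equal refl refl = mk⇔ (λ p → contradiction p (ℚP.<-irrefl refl)) (λ p → contradiction p (ℕP.<-irrefl refl))
  ... | below t< m<     = mk⇔ (λ _ → m<) (λ _ → t<)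

  ∈I⇒In : ∀ {I m t} → Grid I → Sec m (scale t) → t ∈I I → In I m
  ∈I⇒In (gl , gu) s (l , u) = Equivalence.to (inL⇔ gl s) l , Equivalence.to (inU⇔ gu s) u

  In⇒∈I : ∀ {I m t} → Grid I → Sec m (scale t) → In I m → t ∈I I
  In⇒∈I (gl , gu) s (l , u) = Equivalence.from (inL⇔ gl s) l , Equivalence.from (inU⇔ gu s) u

  -- Beyond cell `horizon` every grid endpoint has been passed.
  horizon : ℕ
  horizon = dbl (suc (dbl Z))

  grid<horizon : ∀ {q} → GridPoint q → dbl (grid q) ℕ.< horizon
  grid<horizon g = ℕP.m≤n⇒m≤1+n (ℕ.s≤s (dbl-mono-≤ (GridPoint.upper g)))

  InL-far : ∀ {l m} → GridL l → horizon ℕ.≤ m → InL l m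
  InL-far { -∞ }      _ _ = tt
  InL-far {closedL q} g h = ℕP.<⇒≤ (ℕP.<-≤-trans (grid<horizon g) h)
  InL-far {openL q}   g h = ℕP.<-≤-trans (grid<horizon g) h

  InU-far : ∀ {u m m′} → GridU u → horizon ℕ.≤ m → InU u m → InU u m′
  InU-far { +∞ }      _ _ _ = tt
  InU-far {closedU q} g h p = contradiction (ℕP.<-≤-trans (grid<horizon g) h) (ℕP.≤⇒≯ p)
  InU-far {openU q}   g h p = contradiction (ℕP.<-≤-trans (grid<horizon g) h) (ℕP.<-asym p)

  -- Past all endpoints every lower bound is met and every finite upper bound is violated, so
  -- membership no longer changes.
  In-far : ∀ {I m m′} → Grid I → horizon ℕ.≤ m → horizon ℕ.≤ m′ → In I m → In I m′
  In-far (gl , gu) h h′ (_ , u) = InL-far gl h′ , InU-far gu h u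

  -- A distance t - s in cell d (of multiples of 1/k) has scale (t - s) in cell 2Z + d.
  Window : Interval → ℕ → ℕ → Set
  Window I n m = ∃ λ d → In I (dbl Z ℕ.+ d) × Diff n m d

  diff-sec : ∀ {d t s} → Cell d (scale t - scale s) → Sec (dbl Z ℕ.+ d) (scale (t - s))
  diff-sec {d} {t} {s} c = cell⇒sec (subst (Cell (dbl Z ℕ.+ d)) (sym (scale-of-diff t s)) (cell-translate Z c))

  ∈I⇒window : ∀ {I n m t s} → NonNegative I → Grid I → Sec n (scale t) → Sec m (scale s) → (t - s) ∈I I → Window I n m
  ∈I⇒window {t = t} {s} nn g st ss t-s∈I with cell-of {scale t - scale s} (≤⇒0≤- (scale-mono-≤ (0≤-⇒≤ (nn _ t-s∈I))))
  ... | d , c = d , ∈I⇒In g (diff-sec {t = t} {s} c) t-s∈I , sec-diff st ss c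

  window⇒∈I : ∀ {I n m t} → Grid I → Sec n (scale t) → Window I n m → ∃ λ s → Sec m (scale s) × (t - s) ∈I I
  window⇒∈I {t = t} g st (d , d∈I , diff) with sec-split st diff
  ... | v , sv , c = unscale v , subst (Sec _) (sym (scale-unscale v)) sv ,
    In⇒∈I g (diff-sec {t = t} {unscale v} (subst (λ x → Cell d (scale t - x)) (sym (scale-unscale v)) c)) d∈I

  window-≤ : ∀ {I n m} → Window I n m → m ℕ.≤ n
  window-≤ {m = m} (d , _ , p) = diff-≤ m p

  -- Restricted to positive sections, because section 0 is a half-line and does not translate.
  window-shift : ∀ {I e b b′} → odd (suc b) ≡ odd (suc b′) → Window I (suc b ℕ.+ e) (suc b) → Window I (suc b′ ℕ.+ e) (suc b′)
  window-shift {b = b} {b′} par (d , d∈I , p) = d , d∈I , sum-shift {b = suc b} {suc b′} par p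

  -- Beyond `horizon` an interval contains all cells or none, so the distance may be replaced by the
  -- index difference `n′ ∸ m′`, which is always attained.
  window-far : ∀ {I n m n′ m′} → Grid I → m ℕ.+ horizon ℕ.< n → m′ ℕ.+ horizon ℕ.< n′ → Window I n m → Window I n′ m′
  window-far {n = n} {m} {n′} {m′} g h h′ (d , d∈I , p) = n′ ℕ.∸ m′ ,
    In-far g (ℕP.≤-trans (diff-far m h p) (ℕP.m≤n+m d (dbl Z)))
      (ℕP.≤-trans (ℕP.m+n≤o⇒m≤o∸n horizon (subst (ℕ._≤ n′) (ℕP.+-comm m′ horizon) (ℕP.<⇒≤ h′))) (ℕP.m≤n+m _ (dbl Z))) d∈I ,
    diff-∸ m′ (ℕP.≤-trans (ℕP.m≤m+n m′ horizon) (ℕP.<⇒≤ h′))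

  -- Makes the search for a distance finite. To a positive section the distance cell is at most `n`;
  -- to section 0 distances are unbounded, but `n + horizon` can stand for all that are larger.
  window-bounded : ∀ {I n m} → Grid I → Window I n m →
                   ∃ λ d → d ℕ.< suc (n ℕ.+ horizon) × In I (dbl Z ℕ.+ d) × Diff n m d
  window-bounded {n = n} {m} g (d , d∈I , p) with d ℕP.<? suc (n ℕ.+ horizon)
  ... | yes lt = d , lt , d∈I , p
  window-bounded {n = n} {zero} g (d , d∈I , p) | no ≮ = n ℕ.+ horizon , ℕP.n<1+n _ ,
    In-far g (far (ℕP.<⇒≤ (ℕP.≮⇒≥ ≮))) (far ℕP.≤-refl) d∈I , ℕP.m≤m+n n horizon
    where far : ∀ {x} → n ℕ.+ horizon ℕ.≤ x → horizon ℕ.≤ dbl Z ℕ.+ x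
          far q = ℕP.≤-trans (ℕP.≤-trans (ℕP.m≤n+m horizon n) q) (ℕP.m≤n+m _ (dbl Z))
  window-bounded {n = n} {suc m} g (d , d∈I , p) | no ≮ = contradiction (ℕ.s≤s (ℕP.≤-trans (d≤n p) (ℕP.m≤m+n n horizon))) ≮
    where d≤n : SumCell d (suc m) n → d ℕ.≤ n
          d≤n (inj₁ refl) = ℕP.m≤m+n d (suc m)
          d≤n (inj₂ (_ , _ , inj₁ refl)) = ℕP.≤-trans (ℕP.n≤1+n d) (ℕP.m≤m+n (suc d) (suc m))
          d≤n (inj₂ (_ , _ , inj₂ eq)) = subst (d ℕ.≤_) (ℕP.suc-injective (trans (sym (ℕP.+-suc d m)) eq)) (ℕP.m≤m+n d m)

  window? : ∀ {I} → Grid I → ∀ n m → Dec (Window I n m)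
  window? {I} g n m = map′ (λ (d , _ , p) → d , p) (window-bounded g)
    (ℕP.anyUpTo? (λ d → In? I (dbl Z ℕ.+ d) ×-dec diff? n m d) (suc (n ℕ.+ horizon)))

-- Finite search and the pigeonhole principle

extract : ∀ {X : Set} {P : X → Set} (xs : List X) → (∀ {x} → x ∈ xs → Dec (P x)) →
          (∃ λ x → ∃ λ ys → x ∈ xs × P x × length xs ≡ suc (length ys) ×
            (∀ {y} → y ∈ ys → y ∈ xs) × (∀ {y} → y ∈ xs → y ≡ x ⊎ y ∈ ys))
          ⊎ (∀ {x} → x ∈ xs → ¬ P x)
extract [] P? = inj₂ λ ()
extract (x ∷ xs) P? with P? (here refl)
... | yes p = inj₁ (x , xs , here refl , p , refl , there , λ { (here e) → inj₁ e ; (there i) → inj₂ i })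
... | no ¬p with extract xs (P? ∘ there)
... | inj₂ none = inj₂ λ { (here refl) → ¬p ; (there i) → none i }
... | inj₁ (z , ys , z∈ , p , len , back , split) = inj₁ (z , x ∷ ys , there z∈ , p , cong suc len ,
  (λ { (here e) → here e ; (there i) → there (back i) }) ,
  λ { (here e) → inj₂ (here e) ; (there i) → Sum.map₂ there (split i) })

does≡⇒⇔ : ∀ {P Q : Set} (p? : Dec P) (q? : Dec Q) → does p? ≡ does q? → P ⇔ Q
does≡⇒⇔ (yes p) (yes q) _ = mk⇔ (λ _ → q) (λ _ → p)
does≡⇒⇔ (no ¬p) (no ¬q) _ = mk⇔ (λ p → contradiction p ¬p) (λ q → contradiction q ¬q)

bit : Bool → Fin 2
bit false = Fin.zero
bit true  = Fin.suc Fin.zero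

bit-injective : ∀ {x y} → bit x ≡ bit y → x ≡ y
bit-injective {false} {false} _ = refl
bit-injective {true}  {true}  _ = refl

-- The truth values of all statements of `xs` at one index form a number below `2 ^ length xs`; one
-- index more than there are such numbers forces a repetition. Decidability is what makes this
-- number computable.
indistinguishable : ∀ {X : Set} {P : X → ℕ → Set} → (∀ x n → Dec (P x n)) → (xs : List X) →
                    ∃ λ i → ∃ λ j → i ℕ.< j × (∀ {x} → x ∈ xs → P x i ⇔ P x j)
indistinguishable {P = P} P? xs with FinP.pigeonhole {2 ℕ.^ length xs} (ℕP.n<1+n _)
    (λ i → Fin.funToFin (λ q → bit (does (P? (List.lookup xs q) (Fin.toℕ i)))))
... | i , j , i<j , eq = Fin.toℕ i , Fin.toℕ j , i<j , λ {x} x∈ →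
  subst (λ y → P y (Fin.toℕ i) ⇔ P y (Fin.toℕ j)) (sym (AnyP.lookup-index x∈))
    (does≡⇒⇔ (P? _ _) (P? _ _) (bit-injective (agree (Any.index x∈))))
  where
  agree : ∀ q → bit (does (P? (List.lookup xs q) (Fin.toℕ i))) ≡ bit (does (P? (List.lookup xs q) (Fin.toℕ j)))
  agree q = trans (sym (FinP.finToFun-funToFin _ q)) (trans (cong (λ f → Fin.finToFun f q) eq) (FinP.finToFun-funToFin _ q))

-- Database facts count as rules whose body restricts only the time, so derivations need no separate
-- base case.
data GRule (A : Set) : Set where
  factG : Interval → A → GRule A
  hornG : List A → A → GRule A
  boxG  : Interval → A → A → GRule A
  diaG  : Interval → A → A → GRule A

head : ∀ {A} → GRule A → A
head (factG _ h)  = h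
head (hornG _ h)  = h
head (boxG _ _ h) = h
head (diaG _ _ h) = h

-- Derivability over sections: decidability and eventual repetition

module Derivation (k Z : ℕ) (0<k : 0 ℕ.< k) {A : Set} (_≟_ : DecidableEquality A) where

  open Timeline k Z 0<k
  open DecMembership _≟_ using (_∈?_)

  GridRule : GRule A → Set
  GridRule (factG I _)  = Grid I
  GridRule (hornG _ _)  = ⊤
  GridRule (boxG I _ _) = Grid I
  GridRule (diaG I _ _) = Grid I

  -- Parametric in the valuation `V`: the same clauses serve derivability, the partial knowledge
  -- during saturation, and induction hypotheses.
  Body : (A → ℕ → Set) → GRule A → ℕ → Set
  Body V (factG I _)  n = In I n
  Body V (hornG as _) n = All (λ a → V a n) as
  Body V (boxG I a _) n = ∀ m → Window I n m → V a m
  Body V (diaG I a _) n = ∃ λ m → Window I n m × V a m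

  -- Windows never reach beyond `n`, so knowledge up to `n` suffices, even for the universally
  -- quantified body of ⊟.
  body-map : ∀ {V V′ : A → ℕ → Set} r {n} → (∀ {a m} → m ℕ.≤ n → V a m → V′ a m) → Body V r n → Body V′ r n
  body-map (factG I _)  f p           = p
  body-map (hornG as _) f p           = All.map (f ℕP.≤-refl) p
  body-map (boxG I _ _) f p m w       = f (window-≤ {I} w) (p m w)
  body-map (diaG I _ _) f (m , w , v) = m , w , f (window-≤ {I} w) v

  body? : ∀ {V : A → ℕ → Set} → (∀ a m → Dec (V a m)) → ∀ r → GridRule r → ∀ n → Dec (Body V r n)
  body? V? (factG I _)  g n = In? I n
  body? V? (hornG as _) g n = All.all? (λ a → V? a n) as
  body? V? (boxG I a _) g n = map′
    (λ all m w → all (ℕ.s≤s (window-≤ {I} w)) w) (λ p {m} _ → p m)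
    (ℕP.allUpTo? (λ m → window? g n m →-dec V? a m) (suc n))
  body? V? (diaG I a _) g n = map′
    (λ (m , _ , p) → m , p) (λ (m , w , v) → m , ℕ.s≤s (window-≤ {I} w) , w , v)
    (ℕP.anyUpTo? (λ m → window? g n m ×-dec V? a m) (suc n))

  module _ (G : List (GRule A)) where

    data Der : A → ℕ → Set where
      derive : ∀ {r n} → r ∈ G → Body Der r n → Der (head r) n

    module _ (P : A → ℕ → Set)
             (step : ∀ {r n} → r ∈ G → Body (λ a m → Der a m × P a m) r n → P (head r) n) where

      der-ind  : ∀ {a n} → Der a n → P a n
      der-ind* : ∀ {as n} → All (λ a → Der a n) as → All (λ a → Der a n × P a n) as

      der-ind (derive {factG _ _} r p)            = step r p
      der-ind (derive {hornG _ _} r p)            = step r (der-ind* p)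
      der-ind (derive {boxG _ _ _} r p)           = step r λ m w → p m w , der-ind (p m w)
      der-ind (derive {diaG _ _ _} r (m , w , d)) = step r (m , w , d , der-ind d)

      der-ind* []       = []
      der-ind* (d ∷ ds) = (d , der-ind d) ∷ der-ind* ds

    heads : List A
    heads = map head G

    der-head : ∀ {a n} → Der a n → a ∈ heads
    der-head (derive r _) = ∈-map⁺ head r

    module _ (grid : All GridRule G) where

      module Saturation (n : ℕ) (past? : ∀ {m} → m ℕ.< n → ∀ a → Dec (Der a m)) where

        -- A window may contain the current section itself, so bodies are evaluated against the
        -- settled past together with the atoms collected so far for the present.
        Known : List A → A → ℕ → Set
        Known S a m = m ℕ.< n × Der a m ⊎ m ≡ n × a ∈ S

        known? : ∀ S a m → Dec (Known S a m)
        known? S a m = earlier ⊎-dec ((m ℕP.≟ n) ×-dec (a ∈? S))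
          where
          earlier : Dec (m ℕ.< n × Der a m)
          earlier with m ℕP.<? n
          ... | yes m<n = map′ (m<n ,_) proj₂ (past? m<n a)
          ... | no  m≮n = no λ (m<n , _) → m≮n m<n

        Saturated : List A → Set
        Saturated S = ∀ {r} → r ∈ G → Body (Known S) r n → head r ∈ S

        -- R holds the rules that have not fired yet, so its length bounds the number of rounds.
        saturate : ∀ fuel R → length R ≡ fuel → (∀ {r} → r ∈ R → r ∈ G) →
                   ∀ S → (∀ {a} → a ∈ S → Der a n) → (∀ {r} → r ∈ G → r ∈ R ⊎ head r ∈ S) →
                   ∃ λ S′ → (∀ {a} → a ∈ S′ → Der a n) × Saturated S′
        saturate fuel R len R⊆G S sound rest
          with extract {P = λ r → Body (Known S) r n} R (λ {r} r∈R → body? (known? S) r (All.lookup grid (R⊆G r∈R)) n)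
        ... | inj₂ stuck = S , sound , λ r∈G b → Sum.[ (λ r∈R → contradiction b (stuck r∈R)) , id ]′ (rest r∈G)
        saturate (suc fuel) R eq R⊆G S sound rest | inj₁ (r , R′ , r∈R , fires , len , R′⊆R , split) =
          saturate fuel R′ (ℕP.suc-injective (trans (sym len) eq)) (R⊆G ∘ R′⊆R) (head r ∷ S) sound′ rest′
          where
          sound′ : ∀ {a} → a ∈ head r ∷ S → Der a n
          sound′ (here refl) = derive (R⊆G r∈R) (body-map r
            (λ _ → λ { (inj₁ (_ , d)) → d ; (inj₂ (refl , a∈S)) → sound a∈S }) fires)
          sound′ (there a∈S) = sound a∈S
          rest′ : ∀ {q} → q ∈ G → q ∈ R′ ⊎ head q ∈ head r ∷ S
          rest′ q∈G with rest q∈G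
          ... | inj₂ h∈S = inj₂ (there h∈S)
          ... | inj₁ q∈R with split q∈R
          ... | inj₁ refl = inj₂ (here refl)
          ... | inj₂ q∈R′ = inj₁ q∈R′
        saturate zero R eq R⊆G S sound rest | inj₁ (r , R′ , _ , _ , len , _) = contradiction (trans (sym eq) len) λ ()

        -- The premises of a derivation wander into the past, hence an induction over all sections
        -- with membership claimed only at `n`; earlier premises enter `Known` through their
        -- derivability.
        saturated-complete : ∀ {S} → Saturated S → ∀ {a} → Der a n → a ∈ S
        saturated-complete {S} sat d = der-ind (λ a m → m ≡ n → a ∈ S)
          (λ { {r} r∈G b refl → sat r∈G (body-map r known b) }) d refl
          where
          known : ∀ {a m} → m ℕ.≤ n → Der a m × (m ≡ n → a ∈ S) → Known S a m
          known m≤n (d , p) with ℕP.m≤n⇒m<n∨m≡n m≤n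
          ... | inj₁ m<n = inj₁ (m<n , d)
          ... | inj₂ m≡n = inj₂ (m≡n , p m≡n)

        present? : ∀ a → Dec (Der a n)
        present? a with saturate (length G) G refl id [] (λ ()) inj₁
        ... | S , sound , sat = map′ sound (saturated-complete sat) (a ∈? S)

      der? : ∀ n a → Dec (Der a n)
      der? = <-rec _ λ n past? → Saturation.present? n past?

      -- What derivability from section suc b + horizon on can depend on: `recent` covers the sections from
      -- suc b to suc b + horizon, `always` and `once` what unbounded ⊟ and ◇⁻ see of the older ones.
      record Alike (b b′ : ℕ) : Set where
        field
          parity : odd b ≡ odd b′
          recent : ∀ a {e} → e ℕ.< horizon → Der a (suc b ℕ.+ e) ⇔ Der a (suc b′ ℕ.+ e)
          always : ∀ a → (∀ {j} → j ℕ.< suc b → Der a j) ⇔ (∀ {j} → j ℕ.< suc b′ → Der a j)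
          once   : ∀ a → (∃ λ j → j ℕ.< suc b × Der a j) ⇔ (∃ λ j → j ℕ.< suc b′ × Der a j)

      alike-sym : ∀ {b b′} → Alike b b′ → Alike b′ b
      alike-sym h = record
        { parity  = sym parity
        ; recent  = λ a e< → ⇔-sym (recent a e<)
        ; always  = λ a → ⇔-sym (always a)
        ; once    = λ a → ⇔-sym (once a) }
        where open Alike h

      -- This is the first section that `recent` leaves open. Bodies can refer to this very section,
      -- hence induction on derivations. Sections are `old`, more than `horizon` away, or `new`, and
      -- then matched by their offset.
      alike-der : ∀ {b b′} → Alike b b′ → ∀ {a} → Der a (suc b ℕ.+ horizon) → Der a (suc b′ ℕ.+ horizon)
      alike-der {b} {b′} h d = der-ind P step d refl
        where
        open Alike h
        P : A → ℕ → Set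
        P a n = n ≡ suc b ℕ.+ horizon → Der a (suc b′ ℕ.+ horizon)
        transfer : ∀ a {e} → e ℕ.≤ horizon → Der a (suc b ℕ.+ e) × P a (suc b ℕ.+ e) → Der a (suc b′ ℕ.+ e)
        transfer a e≤ (d , p) with ℕP.m≤n⇒m<n∨m≡n e≤
        ... | inj₁ e<   = Equivalence.to (recent a e<) d
        ... | inj₂ refl = p refl
        far : ∀ {I c c′ m m′} → Grid I → m ℕ.< suc c → m′ ℕ.< suc c′ →
              Window I (suc c ℕ.+ horizon) m → Window I (suc c′ ℕ.+ horizon) m′
        far {I} g lt lt′ = window-far {I} g (ℕP.+-monoˡ-< horizon lt) (ℕP.+-monoˡ-< horizon lt′)
        near : ∀ {I} c c′ e → odd c ≡ odd c′ → e ℕ.≤ horizon →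
               Window I (suc c ℕ.+ horizon) (suc c ℕ.+ e) → Window I (suc c′ ℕ.+ horizon) (suc c′ ℕ.+ e)
        near {I} c c′ e par e≤ w = subst (λ n → Window I n (suc c′ ℕ.+ e)) (end c′)
          (window-shift {I} {b = c ℕ.+ e} {c′ ℕ.+ e}
            (subst₂ (λ x y → odd (suc x) ≡ odd (suc y)) (ℕP.+-comm e c) (ℕP.+-comm e c′) (odd-cong-+ c c′ (suc e) par))
            (subst (λ n → Window I n (suc c ℕ.+ e)) (sym (end c)) w))
          where
          end : ∀ x → suc (x ℕ.+ e) ℕ.+ (horizon ℕ.∸ e) ≡ suc x ℕ.+ horizon
          end x = cong suc (trans (ℕP.+-assoc x e _) (cong (x ℕ.+_) (ℕP.m+[n∸m]≡n e≤)))
        data Split (c m : ℕ) : Set where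
          old : m ℕ.< suc c → Split c m
          new : ∀ e → e ℕ.≤ horizon → m ≡ suc c ℕ.+ e → Split c m
        split : ∀ c {m} → m ℕ.≤ suc c ℕ.+ horizon → Split c m
        split c {m} m≤ with m ℕP.<? suc c
        ... | yes m< = old m<
        ... | no  m≮ = new (m ℕ.∸ suc c) (ℕP.m≤n+o⇒m∸n≤o m (suc c) m≤) (sym (ℕP.m+[n∸m]≡n (ℕP.≮⇒≥ m≮)))
        step : ∀ {r n} → r ∈ G → Body (λ a m → Der a m × P a m) r n → P (head r) n
        step {r} r∈G body refl = derive r∈G (body′ r (All.lookup grid r∈G) body)
          where
          body′ : ∀ r → GridRule r → Body (λ a m → Der a m × P a m) r (suc b ℕ.+ horizon) → Body Der r (suc b′ ℕ.+ horizon)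
          body′ (factG I _)  g p = In-far {I} g (ℕP.m≤n+m horizon (suc b)) (ℕP.m≤n+m horizon (suc b′)) p
          body′ (hornG as _) g p = All.map (λ (_ , q) → q refl) p
          body′ (boxG I a _) g p m w with split b′ (window-≤ {I} w)
          -- One old section in the window on one side puts all old sections of the other side into
          -- the window there, so the box body yields the whole premise of `always`.
          ... | old m<        = Equivalence.to (always a) (λ j< → proj₁ (p _ (far {I} g m< j< w))) m<
          ... | new e e≤ refl = transfer a e≤ (p _ (near {I} b′ b e (sym parity) e≤ w))
          body′ (diaG I a _) g (m , w , d) with split b (window-≤ {I} w)
          -- Dually, whichever old witness `once` returns lies in the window.
          ... | old m<        = let j , j< , d′ = Equivalence.to (once a) (m , m< , proj₁ d) in j , far {I} g m< j< w , d′
          ... | new e e≤ refl = suc b′ ℕ.+ e , near {I} b b′ e parity e≤ w , transfer a e≤ d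

      alike-der⇔ : ∀ {b b′} → Alike b b′ → ∀ a → Der a (suc b ℕ.+ horizon) ⇔ Der a (suc b′ ℕ.+ horizon)
      alike-der⇔ h a = mk⇔ (alike-der h) (alike-der (alike-sym h))

      -- The comparison slides on by one section: `alike-der⇔` supplies the newest recent section,
      -- and the oldest one passes into the range of `always` and `once`.
      alike-suc : ∀ {b b′} → Alike b b′ → Alike (suc b) (suc b′)
      alike-suc {b} {b′} h = record
        { parity = odd-cong-+ b b′ 1 parity
        ; recent = recent⁺
        ; always = λ a → mk⇔ (always⁺ h a) (always⁺ (alike-sym h) a)
        ; once   = λ a → mk⇔ (once⁺ h a) (once⁺ (alike-sym h) a) }
        where
        open Alike h
        recent⁺ : ∀ a {e} → e ℕ.< horizon → Der a (suc (suc b) ℕ.+ e) ⇔ Der a (suc (suc b′) ℕ.+ e)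
        recent⁺ a {e} e< = subst₂ (λ x y → Der a x ⇔ Der a y) (ℕP.+-suc (suc b) e) (ℕP.+-suc (suc b′) e) (at (ℕP.m≤n⇒m<n∨m≡n e<))
          where
          at : suc e ℕ.< horizon ⊎ suc e ≡ horizon → Der a (suc b ℕ.+ suc e) ⇔ Der a (suc b′ ℕ.+ suc e)
          at (inj₁ lt) = recent a lt
          at (inj₂ eq) = subst (λ x → Der a (suc b ℕ.+ x) ⇔ Der a (suc b′ ℕ.+ x)) (sym eq) (alike-der⇔ h a)
        now : ∀ {c c′} → Alike c c′ → ∀ a → Der a (suc c) → Der a (suc c′)
        now {c} {c′} h a = subst₂ (λ x y → Der a x → Der a y) (ℕP.+-identityʳ (suc c)) (ℕP.+-identityʳ (suc c′))
          (Equivalence.to (Alike.recent h a (ℕ.s≤s ℕ.z≤n)))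
        always⁺ : ∀ {c c′} → Alike c c′ → ∀ a → (∀ {j} → j ℕ.< suc (suc c) → Der a j) → ∀ {j} → j ℕ.< suc (suc c′) → Der a j
        always⁺ h a f j< with ℕP.m≤n⇒m<n∨m≡n (ℕP.≤-pred j<)
        ... | inj₁ lt   = Equivalence.to (Alike.always h a) (f ∘ ℕP.m<n⇒m<1+n) lt
        ... | inj₂ refl = now h a (f (ℕP.n<1+n _))
        once⁺ : ∀ {c c′} → Alike c c′ → ∀ a → (∃ λ j → j ℕ.< suc (suc c) × Der a j) → ∃ λ j → j ℕ.< suc (suc c′) × Der a j
        once⁺ h a (j , j< , d) with ℕP.m≤n⇒m<n∨m≡n (ℕP.≤-pred j<)
        ... | inj₁ lt   = let j′ , lt′ , d′ = Equivalence.to (Alike.once h a) (j , lt , d) in j′ , ℕP.m<n⇒m<1+n lt′ , d′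
        ... | inj₂ refl = _ , ℕP.n<1+n _ , now h a d

      alike-+ : ∀ c {b b′} → Alike b b′ → Alike (c ℕ.+ b) (c ℕ.+ b′)
      alike-+ zero    h = h
      alike-+ (suc c) h = alike-suc (alike-+ c h)

      -- The pair stays alike when both members are shifted by `x * p`, so each further period is
      -- one more use of `alike-der⇔`.
      alike-periodic : ∀ p {b} → Alike b (p ℕ.+ b) → ∀ x a →
                       Der a (suc (x ℕ.* p ℕ.+ b) ℕ.+ horizon) ⇔ Der a (suc b ℕ.+ horizon)
      alike-periodic p h zero    a = ⇔-refl
      alike-periodic p {b} h (suc x) a = ⇔-trans (⇔-sym
        (subst (λ y → Der a (suc (x ℕ.* p ℕ.+ b) ℕ.+ horizon) ⇔ Der a (suc y ℕ.+ horizon)) eq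
          (alike-der⇔ (alike-+ (x ℕ.* p) h) a))) (alike-periodic p h x a)
        where
        eq : x ℕ.* p ℕ.+ (p ℕ.+ b) ≡ suc x ℕ.* p ℕ.+ b
        eq = trans (sym (ℕP.+-assoc (x ℕ.* p) p b)) (cong (ℕ._+ b) (ℕP.+-comm (x ℕ.* p) p))

      data Query : Set where
        recentQ         : A → ℕ → Query
        alwaysQ onceQ : A → Query

      Holds : Query → ℕ → Set
      Holds (recentQ a e) b = Der a (suc b ℕ.+ e)
      Holds (alwaysQ a)   b = ∀ {j} → j ℕ.< suc b → Der a j
      Holds (onceQ a)     b = ∃ λ j → j ℕ.< suc b × Der a j

      holds? : ∀ q b → Dec (Holds q b)
      holds? (recentQ a e) b = der? (suc b ℕ.+ e) a
      holds? (alwaysQ a)   b = ℕP.allUpTo? (λ j → der? j a) (suc b)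
      holds? (onceQ a)     b = ℕP.anyUpTo? (λ j → der? j a) (suc b)

      queriesOn : A → List Query
      queriesOn a = alwaysQ a ∷ onceQ a ∷ map (recentQ a) (upTo horizon)

      queries : List Query
      queries = concatMap queriesOn heads

      -- Sections are sampled along `β`, where parity is constant. Only rule heads need queries: for
      -- any other atom both sides of each equivalence are false.
      alike-pair : (β : ℕ → ℕ) → (∀ x y → odd (β x) ≡ odd (β y)) →
                   ∃ λ x → ∃ λ y → x ℕ.< y × Alike (β x) (β y)
      alike-pair β parity with indistinguishable {P = λ q x → Holds q (β x)} (λ q x → holds? q (β x)) queries
      ... | x , y , x<y , same = x , y , x<y , record
        { parity = parity x y
        ; recent = λ a e< → relevant (λ h → same (query h (there (there (∈-map⁺ (recentQ a) (∈-upTo⁺ e<)))))) der-head der-head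
        -- The range of `j` contains 0, so even `always` provides a derivation and thereby a head.
        ; always = λ a → relevant (λ h → same (query h (here refl))) (λ f → der-head (f (ℕ.s≤s ℕ.z≤n))) (λ f → der-head (f (ℕ.s≤s ℕ.z≤n)))
        ; once   = λ a → relevant (λ h → same (query h (there (here refl)))) (λ (_ , _ , d) → der-head d) (λ (_ , _ , d) → der-head d) }
        where
        query : ∀ {a q} → a ∈ heads → q ∈ queriesOn a → q ∈ queries
        query a∈ q∈ = ∈-concatMap⁺ queriesOn (Any.map (λ { refl → q∈ }) a∈)
        relevant : ∀ {a} {X Y : Set} → (a ∈ heads → X ⇔ Y) → (X → a ∈ heads) → (Y → a ∈ heads) → X ⇔ Y
        relevant f g g′ = mk⇔ (λ x → Equivalence.to (f (g x)) x) (λ y → Equivalence.from (f (g′ y)) y)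

-- The left side is how `alike-periodic` presents the section `x` periods later, the right side the
-- cell of the grid point of the time `T₀ + p * x`.
period-index : ∀ x k p x₀ Z → suc (x ℕ.* dbl (k ℕ.* p) ℕ.+ suc (dbl (k ℕ.* x₀))) ℕ.+ dbl (suc (dbl Z)) ≡
               dbl (suc (k ℕ.* x₀) ℕ.+ suc (dbl Z) ℕ.+ k ℕ.* (p ℕ.* x))
period-index x k p x₀ Z rewrite dbl≡+ (k ℕ.* p) | dbl≡+ (k ℕ.* x₀) | dbl≡+ (dbl Z)
  | dbl≡+ (k ℕ.* x₀ ℕ.+ suc (dbl Z) ℕ.+ k ℕ.* (p ℕ.* x)) =
  solve 5 (λ x k p x₀ z →
    con 1 :+ (x :* (k :* p :+ k :* p) :+ (con 1 :+ (k :* x₀ :+ k :* x₀))) :+ (con 2 :+ (z :+ z)) :=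
    con 2 :+ ((k :* x₀ :+ (con 1 :+ z) :+ k :* (p :* x)) :+ (k :* x₀ :+ (con 1 :+ z) :+ k :* (p :* x))))
    refl x k p x₀ (dbl Z)
  where open +-*-Solver

-- A common grid for finitely many rationals

module CommonGrid where
  open Q using (_+_; _*_)

  -- Says that `k * q` is an integer, written as the difference `m - n` of naturals.
  OnGrid : ℕ → ℚ → Set
  OnGrid k q = ∃ λ m → ∃ λ n → ι k * q + ι n ≡ ι m

  abstract
    clear-denominator⁺ : ∀ n d .(c : Coprimality.Coprime n (suc d)) → ι (suc d) * mkℚ (+ n) d c ≡ ι n
    clear-denominator⁺ n d c = ℚP.toℚᵘ-injective (QᵘP.≃-trans (ℚP.toℚᵘ-homo-* (ι (suc d)) (mkℚ (+ n) d c)) eq)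
      where
      eq : Q.toℚᵘ (ι (suc d)) Qᵘ.* Q.toℚᵘ (mkℚ (+ n) d c) Qᵘ.≃ Q.toℚᵘ (ι n)
      eq rewrite ι≡toℚ (suc d) | ι≡toℚ n | toℚ≡mkℚ (suc d) | toℚ≡mkℚ n = Qᵘ.*≡* (begin
        (+ suc d ℤ.* + n) ℤ.* + 1         ≡⟨ ℤP.*-identityʳ _ ⟩
        + suc d ℤ.* + n                   ≡⟨ ℤP.*-comm (+ suc d) (+ n) ⟩
        + n ℤ.* + suc d                   ≡⟨ cong (λ x → + n ℤ.* + suc x) (sym (ℕP.+-identityʳ d)) ⟩
        + n ℤ.* + suc (d ℕ.+ 0)           ∎)
        where open ≡-Reasoning

  clear-denominator : ∀ q → ∃ λ d → 0 ℕ.< d × OnGrid d q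
  clear-denominator (mkℚ (+ n) d c) = suc d , ℕ.s≤s ℕ.z≤n , n , 0 ,
    trans (cong₂ _+_ (clear-denominator⁺ n d c) ι-0) (ℚP.+-identityʳ (ι n))
  clear-denominator (mkℚ -[1+ n ] d c) = suc d , ℕ.s≤s ℕ.z≤n , 0 , suc n , (begin
    ι (suc d) * Q.- p + ι (suc n)       ≡⟨ cong (_+ ι (suc n)) (sym (ℚP.neg-distribʳ-* (ι (suc d)) p)) ⟩
    Q.- (ι (suc d) * p) + ι (suc n)     ≡⟨ cong (λ x → Q.- x + ι (suc n)) (clear-denominator⁺ (suc n) d c) ⟩
    Q.- ι (suc n) + ι (suc n)           ≡⟨ ℚP.+-inverseˡ (ι (suc n)) ⟩
    0ℚ                                  ≡⟨ sym ι-0 ⟩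
    ι 0                                 ∎)
    where
    open ≡-Reasoning
    p = mkℚ (+ suc n) d c

  onGrid-* : ∀ e {k q} → OnGrid k q → OnGrid (e ℕ.* k) q
  onGrid-* e {k} {q} (m , n , eq) = e ℕ.* m , e ℕ.* n , (begin
    ι (e ℕ.* k) * q + ι (e ℕ.* n)       ≡⟨ cong₂ (λ x y → x * q + y) (ι-* e k) (ι-* e n) ⟩
    ι e * ι k * q + ι e * ι n           ≡⟨ cong (_+ (ι e * ι n)) (ℚP.*-assoc (ι e) (ι k) q) ⟩
    ι e * (ι k * q) + ι e * ι n         ≡⟨ sym (ℚP.*-distribˡ-+ (ι e) (ι k * q) (ι n)) ⟩
    ι e * (ι k * q + ι n)               ≡⟨ cong (ι e *_) eq ⟩
    ι e * ι m                           ≡⟨ sym (ι-* e m) ⟩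
    ι (e ℕ.* m)                         ∎)
    where open ≡-Reasoning

  common-denominator : ∀ qs → ∃ λ k → 0 ℕ.< k × All (OnGrid k) qs
  common-denominator [] = 1 , ℕ.s≤s ℕ.z≤n , []
  common-denominator (q ∷ qs) with clear-denominator q | common-denominator qs
  ... | d , 0<d , g | k , 0<k , gs = k ℕ.* d , ℕP.*-mono-< 0<k 0<d , onGrid-* k g ∷
    All.map (λ {q} g → subst (λ x → OnGrid x q) (ℕP.*-comm d k) (onGrid-* d g)) gs

  -- After translation by `Z` the point becomes `m + (Z - n)`: the strict bound on `n` makes it at
  -- least 1, the bound on `m` at most `2Z`.
  Within : ℕ → ℕ → ℚ → Set
  Within k Z q = ∃ λ m → ∃ λ n → ι k * q + ι n ≡ ι m × m ℕ.≤ Z × n ℕ.< Z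

  within-mono : ∀ {k Z Z′ q} → Z ℕ.≤ Z′ → Within k Z q → Within k Z′ q
  within-mono le (m , n , eq , m≤ , n<) = m , n , eq , ℕP.≤-trans m≤ le , ℕP.<-≤-trans n< le

  within⇒gridPoint : ∀ {k Z} 0<k {q} → Within k Z q → Timeline.GridPoint k Z 0<k q
  within⇒gridPoint {k} {Z} 0<k {q} (m , n , eq , m≤ , n<) =
    Timeline.gridPoint k Z 0<k {E = m ℕ.+ (Z ℕ.∸ n)} (begin
      ι k * q + ι Z                         ≡⟨ cong (λ x → ι k * q + ι x) (sym (ℕP.m+[n∸m]≡n (ℕP.<⇒≤ n<))) ⟩
      ι k * q + ι (n ℕ.+ (Z ℕ.∸ n))         ≡⟨ cong (λ x → ι k * q + x) (ι-+ n (Z ℕ.∸ n)) ⟩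
      ι k * q + (ι n + ι (Z ℕ.∸ n))         ≡⟨ sym (ℚP.+-assoc (ι k * q) (ι n) (ι (Z ℕ.∸ n))) ⟩
      ι k * q + ι n + ι (Z ℕ.∸ n)           ≡⟨ cong (_+ ι (Z ℕ.∸ n)) eq ⟩
      ι m + ι (Z ℕ.∸ n)                     ≡⟨ sym (ι-+ m (Z ℕ.∸ n)) ⟩
      ι (m ℕ.+ (Z ℕ.∸ n))                   ∎)
      (ℕP.≤-trans (ℕP.m<n⇒0<n∸m n<) (ℕP.m≤n+m _ m))
      (subst (m ℕ.+ (Z ℕ.∸ n) ℕ.≤_) (sym (dbl≡+ Z)) (ℕP.+-mono-≤ m≤ (ℕP.m∸n≤m Z n)))
    where open ≡-Reasoning

-- Bounds on the symbols and tuple lengths of a program and a database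

bound-all : ∀ {X : Set} {P : ℕ → X → Set} → (∀ {m n x} → m ℕ.≤ n → P m x → P n x) → ∀ {xs} →
            All (λ x → ∃ λ N → P N x) xs → ∃ λ N → All (P N) xs
bound-all mono [] = 0 , []
bound-all mono ((n , p) ∷ ps) with bound-all mono ps
... | N , qs = n ℕ.⊔ N , mono (ℕP.m≤m⊔n n N) p ∷ All.map (mono (ℕP.m≤n⊔m n N)) qs

boundsL : LBound → List ℚ
boundsL -∞          = []
boundsL (closedL q) = q ∷ []
boundsL (openL q)   = q ∷ []

boundsU : UBound → List ℚ
boundsU +∞          = []
boundsU (closedU q) = q ∷ []
boundsU (openU q)   = q ∷ []

bounds : Interval → List ℚ
bounds ⟨ l , u ⟩ = boundsL l ++ boundsU u

ruleBounds : Rule → List ℚ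
ruleBounds (plain _ _)      = []
ruleBounds (boxR I _ _)     = bounds I
ruleBounds (diamondR I _ _) = bounds I

module _ {k Z : ℕ} (0<k : 0 ℕ.< k) where
  open Timeline k Z 0<k

  gridL : ∀ {l} → All GridPoint (boundsL l) → GridL l
  gridL { -∞ }       _       = tt
  gridL {closedL _} (g ∷ []) = g
  gridL {openL _}   (g ∷ []) = g

  gridU : ∀ {u} → All GridPoint (boundsU u) → GridU u
  gridU { +∞ }       _       = tt
  gridU {closedU _} (g ∷ []) = g
  gridU {openU _}   (g ∷ []) = g

  gridI : ∀ {I} → All GridPoint (bounds I) → Grid I
  gridI {⟨ l , u ⟩} g = gridL (AllP.++⁻ˡ (boundsL l) g) , gridU (AllP.++⁻ʳ (boundsL l) g)

-- One `N` bounds variables, constants and, in `AtomWithin`, tuple lengths: it makes the relevant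
-- substitutions finite in number, tells which constants a renaming must fix, and limits how many
-- codes for other constants are needed.
TermWithin : ℕ → Term → Set
TermWithin N (var x)   = x ℕ.< N
TermWithin N (const c) = c ℕ.< N

AtomWithin : ℕ → Atom → Set
AtomWithin N (atom _ τ) = length τ ℕ.≤ N × All (TermWithin N) τ

RuleWithin : ℕ → Rule → Set
RuleWithin N r = All (AtomWithin N) (atomsOf r)

FactWithin : ℕ → Fact → Set
FactWithin N (_ ⟨ c ⟩at _) = length c ℕ.≤ N × All (ℕ._< N) c

term-mono : ∀ {m n} τ → m ℕ.≤ n → TermWithin m τ → TermWithin n τ
term-mono (var _)   le lt = ℕP.<-≤-trans lt le
term-mono (const _) le lt = ℕP.<-≤-trans lt le

atom-mono : ∀ {m n a} → m ℕ.≤ n → AtomWithin m a → AtomWithin n a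
atom-mono le (l , ts) = ℕP.≤-trans l le , All.map (λ {τ} → term-mono τ le) ts

rule-mono : ∀ {m n r} → m ℕ.≤ n → RuleWithin m r → RuleWithin n r
rule-mono le = All.map (λ {a} → atom-mono {a = a} le)

fact-mono : ∀ {m n f} → m ℕ.≤ n → FactWithin m f → FactWithin n f
fact-mono le (l , cs) = ℕP.≤-trans l le , All.map (λ c< → ℕP.<-≤-trans c< le) cs

term-within : ∀ τ → ∃ λ N → TermWithin N τ
term-within (var x)   = suc x , ℕP.n<1+n x
term-within (const c) = suc c , ℕP.n<1+n c

atom-within : ∀ a → ∃ λ N → AtomWithin N a
atom-within (atom _ τ) with bound-all (λ {m} {n} {τ} → term-mono {m} {n} τ) (All.universal term-within τ)
... | N , ts = length τ ℕ.⊔ N , ℕP.m≤m⊔n _ N , All.map (λ {τ} → term-mono τ (ℕP.m≤n⊔m _ N)) ts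

rule-within : ∀ r → ∃ λ N → RuleWithin N r
rule-within r = bound-all (λ {m} {n} {a} → atom-mono {m} {n} {a}) (All.universal atom-within (atomsOf r))

fact-within : ∀ f → ∃ λ N → FactWithin N f
fact-within (_ ⟨ c ⟩at _) with bound-all {P = λ N c → c ℕ.< N} (λ le lt → ℕP.<-≤-trans lt le) (All.universal (λ c → suc c , ℕP.n<1+n c) c)
... | N , cs = length c ℕ.⊔ N , ℕP.m≤m⊔n _ N , All.map (λ c< → ℕP.<-≤-trans c< (ℕP.m≤n⊔m _ N)) cs

-- Grounding over a finite domain

GroundAtom : Set
GroundAtom = Pred × List Const

_≟ᴳ_ : DecidableEquality GroundAtom
_≟ᴳ_ = ×P.≡-dec ℕP._≟_ (ListP.≡-dec ℕP._≟_)

groundAtom : Substitution → Atom → GroundAtom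
groundAtom σ (atom P τ) = P , groundArgs σ τ

groundRule : Substitution → Rule → GRule GroundAtom
groundRule σ (plain as h)     = hornG (map (groundAtom σ) as) (groundAtom σ h)
groundRule σ (boxR I a h)     = boxG I (groundAtom σ a) (groundAtom σ h)
groundRule σ (diamondR I a h) = diaG I (groundAtom σ a) (groundAtom σ h)

groundFact : Fact → GRule GroundAtom
groundFact (P ⟨ c ⟩at I) = factG I (P , c)

_[_↦_] : Substitution → Var → Const → Substitution
(σ [ v ↦ c ]) x with x ℕP.≟ v
... | yes _ = c
... | no  _ = σ x

substitutions : ℕ → ℕ → List Substitution
substitutions M zero    = (λ _ → 0) ∷ []
substitutions M (suc v) = concatMap (λ σ → map (σ [ v ↦_]) (upTo M)) (substitutions M v)

-- Agreement below `v` replaces equality of functions, and suffices because rules mention only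
-- bounded variables.
substitutions-cover : ∀ M v (σ : Substitution) → (∀ x → σ x ℕ.< M) →
                      ∃ λ σ′ → σ′ ∈ substitutions M v × (∀ {x} → x ℕ.< v → σ′ x ≡ σ x)
substitutions-cover M zero σ σ< = _ , here refl , λ ()
substitutions-cover M (suc v) σ σ< with substitutions-cover M v σ σ<
... | σ′ , σ′∈ , agree = σ′ [ v ↦ σ v ] ,
  ∈-concatMap⁺ (λ σ → map (σ [ v ↦_]) (upTo M)) (Any.map (λ { refl → ∈-map⁺ (σ′ [ v ↦_]) (∈-upTo⁺ (σ< v)) }) σ′∈) , agree′
  where
  agree′ : ∀ {x} → x ℕ.< suc v → (σ′ [ v ↦ σ v ]) x ≡ σ x
  agree′ {x} x< with x ℕP.≟ v
  ... | yes refl = refl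
  ... | no  x≢v  = agree (ℕP.≤∧≢⇒< (ℕP.≤-pred x<) x≢v)

ground : ℕ → ℕ → Program → Database → List (GRule GroundAtom)
ground M N Π D = concatMap (λ r → map (λ σ → groundRule σ r) (substitutions M N)) Π ++ map groundFact D

Fixes : ℕ → (Const → Const) → Set
Fixes N f = ∀ {c} → c ℕ.< N → f c ≡ c

-- Renaming commutes with grounding because `f` leaves the constants of these terms in place.
groundArgs-rename : ∀ {N f} {σ σ′ : Substitution} → Fixes N f → (∀ {x} → x ℕ.< N → σ′ x ≡ f (σ x)) →
                    ∀ {τ} → All (TermWithin N) τ → groundArgs σ′ τ ≡ map f (groundArgs σ τ)
groundArgs-rename fix agree []                  = refl
groundArgs-rename fix agree {var x ∷ τ} (p ∷ ps)   = cong₂ _∷_ (agree p) (groundArgs-rename fix agree ps)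
groundArgs-rename fix agree {const c ∷ τ} (p ∷ ps) = cong₂ _∷_ (sym (fix p)) (groundArgs-rename fix agree ps)

-- Entailment coincides with derivability

module Grounding (Π : Program) (D : Database) (N : ℕ) (Π-within : All (RuleWithin N) Π) (D-within : All (FactWithin N) D)
                 (k Z : ℕ) (0<k : 0 ℕ.< k) where

  open Timeline k Z 0<k

  -- All constants of Π and D, and room for N more.
  domainSize : ℕ
  domainSize = suc (N ℕ.+ N)

  G : List (GRule GroundAtom)
  G = ground domainSize N Π D

  open Derivation k Z 0<k _≟ᴳ_ using (GridRule; Body)

  Derivable : GroundAtom → ℕ → Set
  Derivable = Derivation.Der k Z 0<k _≟ᴳ_ G

  open Derivation k Z 0<k _≟ᴳ_ using (derive)

  section : ℚ → ℕ
  section t = proj₁ (sec-of (scale t))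

  section-sec : ∀ t → Sec (section t) (scale t)
  section-sec t = proj₂ (sec-of (scale t))

  rule∈G : ∀ {r σ} → r ∈ Π → σ ∈ substitutions domainSize N → groundRule σ r ∈ G
  rule∈G r∈ σ∈ = ∈-++⁺ˡ (∈-concatMap⁺ _ (Any.map (λ { refl → ∈-map⁺ _ σ∈ }) r∈))

  fact∈G : ∀ {f} → f ∈ D → groundFact f ∈ G
  fact∈G f∈ = ∈-++⁺ʳ _ (∈-map⁺ groundFact f∈)

  data Origin : GRule GroundAtom → Set where
    fromRule : ∀ {r} σ → r ∈ Π → Origin (groundRule σ r)
    fromFact : ∀ {f} → f ∈ D → Origin (groundFact f)

  origin : ∀ {r} → r ∈ G → Origin r
  origin {r} r∈ with ∈-++⁻ (concatMap (λ r → map (λ σ → groundRule σ r) (substitutions domainSize N)) Π) r∈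
  ... | inj₂ q with ∈-map⁻ groundFact q
  ... | f , f∈ , refl = fromFact f∈
  origin {r} r∈ | inj₁ q with find (∈-concatMap⁻ (λ r → map (λ σ → groundRule σ r) (substitutions domainSize N)) q)
  ... | r′ , r′∈ , q′ with ∈-map⁻ (λ σ → groundRule σ r′) q′
  ... | σ , _ , refl = fromRule σ r′∈

  module _ (fp : IsFP Π) (Π-grid : All (λ r → ∀ σ → GridRule (groundRule σ r)) Π)
           (D-grid : All (GridRule ∘ groundFact) D) where

    G-grid : All GridRule G
    G-grid = All.tabulate λ r∈ → grid-origin (origin r∈)
      where
      grid-origin : ∀ {r} → Origin r → GridRule r
      grid-origin (fromRule σ r∈) = All.lookup Π-grid r∈ σ
      grid-origin (fromFact f∈)   = All.lookup D-grid f∈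

    module _ (f : Const → Const) (f-fixes : Fixes N f) (f<domainSize : ∀ c → f c ℕ.< domainSize) where

      -- The length bound makes entailed tuples short enough to be renamed injectively into the finite domain.
      canonical : Interpretation
      canonical P c t = Derivable (P , map f c) (section t) × length c ℕ.≤ N

      module _ {σ σ′ : Substitution} (agree : ∀ {x} → x ℕ.< N → σ′ x ≡ f (σ x)) where

        toGround : ∀ a → AtomWithin N a → ∀ {s} → HoldsAt canonical σ a s → Derivable (groundAtom σ′ a) (section s)
        toGround (atom P τ) (_ , ts) {s} (d , _) =
          subst (λ c → Derivable (P , c) (section s)) (sym (groundArgs-rename f-fixes agree ts)) d

        fromGround : ∀ a → AtomWithin N a → ∀ {s} → Derivable (groundAtom σ′ a) (section s) → HoldsAt canonical σ a s
        fromGround (atom P τ) (l , ts) {s} d =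
          subst (λ c → Derivable (P , c) (section s)) (groundArgs-rename f-fixes agree ts) d ,
          subst (ℕ._≤ N) (sym (ListP.length-map (groundTerm σ) τ)) l

      -- Finitely many instances suffice: `f ∘ σ` takes values in the finite domain, so a listed
      -- substitution agrees with it on all variables of the rule.
      canonical-rule : ∀ {r} → r ∈ Π → SatRule canonical r
      canonical-rule {r} r∈ = go r r∈ (All.lookup Π-within r∈) (All.lookup fp r∈) (All.lookup Π-grid r∈)
        where
        go : ∀ r → r ∈ Π → RuleWithin N r → RuleFP r → (∀ σ → GridRule (groundRule σ r)) → SatRule canonical r
        go r@(plain as h) r∈ (hw ∷ aws) _ _ σ t body with substitutions-cover domainSize N (f ∘ σ) (λ x → f<domainSize (σ x))
        ... | σ′ , σ′∈ , agree = fromGround agree h hw (derive {r = groundRule σ′ r} (rule∈G r∈ σ′∈)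
          (AllP.map⁺ (All.zipWith (λ {a} (aw , p) → toGround agree a aw p) (aws , body))))
        go r@(boxR I a h) r∈ (hw ∷ aw ∷ []) nn grid σ t body
          with substitutions-cover domainSize N (f ∘ σ) (λ x → f<domainSize (σ x))
        ... | σ′ , σ′∈ , agree = fromGround agree h hw (derive {r = groundRule σ′ r} (rule∈G r∈ σ′∈) λ m w →
          let s , ss , t-s∈I = window⇒∈I (grid σ′) (section-sec t) w
          in subst (Derivable (groundAtom σ′ a)) (sec-unique (section-sec s) ss) (toGround agree a aw (body s t-s∈I)))
        go r@(diamondR I a h) r∈ (hw ∷ aw ∷ []) nn grid σ t (s , t-s∈I , p)
          with substitutions-cover domainSize N (f ∘ σ) (λ x → f<domainSize (σ x))
        ... | σ′ , σ′∈ , agree = fromGround agree h hw (derive {r = groundRule σ′ r} (rule∈G r∈ σ′∈)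
          (section s , ∈I⇒window nn (grid σ′) (section-sec t) (section-sec s) t-s∈I , toGround agree a aw p))

      map-fixed : ∀ {c} → All (ℕ._< N) c → map f c ≡ c
      map-fixed c< = ListP.map-id-local (All.map f-fixes c<)

      canonical-fact : ∀ {φ} → φ ∈ D → SatFact canonical φ
      canonical-fact {P ⟨ c ⟩at I} φ∈ t t∈I with All.lookup D-within φ∈
      ... | l , c< = subst (λ c → Derivable (P , c) (section t)) (sym (map-fixed c<))
        (derive {r = factG I (P , c)} (fact∈G φ∈) (∈I⇒In (All.lookup D-grid φ∈) (section-sec t) t∈I)) , l

      canonical-model : IsModel canonical Π D
      canonical-model = All.tabulate canonical-rule , All.tabulate canonical-fact

    module _ (g : Const → Const) (g-fixes : Fixes N g) (M : Interpretation) (model : IsModel M Π D) where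

      -- Truth throughout the section: a box hypothesis must cover every `s` whose section lies in
      -- the window.
      True : GroundAtom → ℕ → Set
      True (P , c) n = ∀ t → Sec n (scale t) → M P (map g c) t

      fromInstance : ∀ σ a → AtomWithin N a → ∀ {t} → HoldsAt M (g ∘ σ) a t →
                     M (proj₁ (groundAtom σ a)) (map g (proj₂ (groundAtom σ a))) t
      fromInstance σ (atom P τ) (_ , ts) {t} = subst (λ c → M P c t) (groundArgs-rename {σ = σ} g-fixes (λ _ → refl) ts)

      toInstance : ∀ σ a → AtomWithin N a → ∀ {n t} → Sec n (scale t) → True (groundAtom σ a) n → HoldsAt M (g ∘ σ) a t
      toInstance σ (atom P τ) (_ , ts) {t = t} st p =
        subst (λ c → M P c t) (sym (groundArgs-rename {σ = σ} g-fixes (λ _ → refl) ts)) (p t st)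

      -- Soundness. For a diamond, `window⇒∈I` finds for each `t` of the section its own witness
      -- `s`, and the induction hypothesis holds at whichever `s` that is.
      derivable⇒true : ∀ {a n} → Derivable a n → True a n
      derivable⇒true = Derivation.der-ind k Z 0<k _≟ᴳ_ G True λ r∈ → step (origin r∈)
        where
        rule-step : ∀ r σ → RuleWithin N r → RuleFP r → GridRule (groundRule σ r) → SatRule M r →
                    ∀ {n} → Body (λ a m → Derivable a m × True a m) (groundRule σ r) n → True (head (groundRule σ r)) n
        rule-step (plain as h) σ (hw ∷ aws) _ _ sat body t st = fromInstance σ h hw (sat (g ∘ σ) t
          (All.zipWith (λ {a} (aw , _ , p) → toInstance σ a aw st p) (aws , AllP.map⁻ body)))
        rule-step (boxR I a h) σ (hw ∷ aw ∷ []) nn grid sat body t st = fromInstance σ h hw (sat (g ∘ σ) t λ s t-s∈I →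
          toInstance σ a aw (section-sec s) (proj₂ (body (section s) (∈I⇒window nn grid st (section-sec s) t-s∈I))))
        rule-step (diamondR I a h) σ (hw ∷ aw ∷ []) nn grid sat (m , w , _ , p) t st =
          let s , ss , t-s∈I = window⇒∈I grid st w
          in fromInstance σ h hw (sat (g ∘ σ) t (s , t-s∈I , toInstance σ a aw ss p))

        step : ∀ {r n} → Origin r → Body (λ a m → Derivable a m × True a m) r n → True (head r) n
        step (fromRule {r} σ r∈) = rule-step r σ
          (All.lookup Π-within r∈) (All.lookup fp r∈) (All.lookup Π-grid r∈ σ) (All.lookup (proj₁ model) r∈)
        step (fromFact {P ⟨ c ⟩at I} f∈) body t st = subst (λ c → M P c t)
          (sym (ListP.map-id-local (All.map g-fixes (proj₂ (All.lookup D-within f∈)))))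
          (All.lookup (proj₂ model) f∈ t (In⇒∈I (All.lookup D-grid f∈) st body))

    module Renaming (τ : List Const) where
      open DecMembership ℕP._≟_ using (_∈?_)

      -- Constants below N stay; any other constant of τ is coded by N plus a position of it in τ.
      encode : Const → Const
      encode c with c ℕP.<? N
      ... | yes _ = c
      ... | no  _ with c ∈? τ
      ... | yes p = N ℕ.+ Fin.toℕ (Any.index p)
      -- These constants need no inverse, but `canonical` needs a total map into the domain; 0
      -- belongs to every domain.
      ... | no  _ = 0

      nth : List Const → ℕ → Const
      nth []       _       = 0
      nth (c ∷ _)  zero    = c
      nth (_ ∷ cs) (suc i) = nth cs i

      decode : Const → Const
      decode d with d ℕP.<? N
      ... | yes _ = d
      ... | no  _ = nth τ (d ℕ.∸ N)

      encode-fixes : Fixes N encode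
      encode-fixes {c} c< with c ℕP.<? N
      ... | yes _ = refl
      ... | no c≮ = contradiction c< c≮

      decode-fixes : Fixes N decode
      decode-fixes {c} c< with c ℕP.<? N
      ... | yes _ = refl
      ... | no c≮ = contradiction c< c≮

      encode<domainSize : length τ ℕ.≤ N → ∀ c → encode c ℕ.< domainSize
      encode<domainSize l c with c ℕP.<? N
      ... | yes c< = ℕP.m<n⇒m<1+n (ℕP.<-≤-trans c< (ℕP.m≤m+n N N))
      ... | no  _ with c ∈? τ
      ... | yes p = ℕ.s≤s (ℕP.+-monoʳ-≤ N (ℕP.<⇒≤ (ℕP.<-≤-trans (FinP.toℕ<n (Any.index p)) l)))
      ... | no  _ = ℕ.s≤s ℕ.z≤n

      nth-index : ∀ {c cs} (p : c ∈ cs) → nth cs (Fin.toℕ (Any.index p)) ≡ c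
      nth-index (here refl) = refl
      nth-index (there p)   = nth-index p

      decode-encode : ∀ {c} → c ∈ τ → decode (encode c) ≡ c
      decode-encode {c} c∈ with c ℕP.<? N
      ... | yes c< = decode-fixes c<
      ... | no  _ with c ∈? τ
      ... | no c∉ = contradiction c∈ c∉
      ... | yes p with (N ℕ.+ Fin.toℕ (Any.index p)) ℕP.<? N
      ... | yes lt = contradiction lt (ℕP.≤⇒≯ (ℕP.m≤m+n N _))
      ... | no  _  = trans (cong (nth τ) (ℕP.m+n∸m≡n N _)) (nth-index p)

      decode-encode-args : map decode (map encode τ) ≡ τ
      decode-encode-args = trans (sym (ListP.map-∘ τ)) (ListP.map-id-local (All.tabulate decode-encode))

      module _ (l : length τ ℕ.≤ N) where

        entailed⇒derivable : ∀ {P n t} → Sec n (scale t) → P ⟨ τ ⟩at t ∈ Π ⟦ D ⟧ → Derivable (P , map encode τ) n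
        entailed⇒derivable {P} {t = t} st h = subst (Derivable (P , map encode τ)) (sec-unique (section-sec t) st)
          (proj₁ (h (canonical encode encode-fixes (encode<domainSize l)) (canonical-model encode encode-fixes (encode<domainSize l))))

        derivable⇒entailed : ∀ {P n t} → Sec n (scale t) → Derivable (P , map encode τ) n → P ⟨ τ ⟩at t ∈ Π ⟦ D ⟧
        derivable⇒entailed {P} {t = t} st d M model = subst (λ c → M P c t) decode-encode-args
          (derivable⇒true decode decode-fixes M model d t st)

    -- `canonical` contains only short tuples. It is taken for the renaming of `[]`, because the
    -- renaming of `τ` is known to land in the domain only once this bound on `τ` is available.
    entailed-length : ∀ {P τ t} → P ⟨ τ ⟩at t ∈ Π ⟦ D ⟧ → length τ ℕ.≤ N
    entailed-length h = proj₂ (h (canonical encode encode-fixes (encode<domainSize ℕ.z≤n))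
      (canonical-model encode encode-fixes (encode<domainSize ℕ.z≤n)))
      where open Renaming []

    open Derivation k Z 0<k _≟ᴳ_ using (alike-pair; alike-periodic)

    alike⇒periodic : ∀ P x₀ y₀ → x₀ ℕ.< y₀ →
      Derivation.Alike k Z 0<k _≟ᴳ_ G G-grid (suc (dbl (k ℕ.* x₀))) (suc (dbl (k ℕ.* y₀))) →
      Σ ℚ λ T → Σ ℕ λ n → n ℕ.> 0 ×
               ((x : ℕ) (τ : List Const) → (P ⟨ τ ⟩at (T Q.+ toℚ (n ℕ.* x)) ∈ Π ⟦ D ⟧) ⇔ (P ⟨ τ ⟩at T ∈ Π ⟦ D ⟧))
    alike⇒periodic P x₀ y₀ x₀<y₀ alike = T₀ , p , ℕP.m<n⇒0<n∸m x₀<y₀ , equiv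
      where
      p i b : ℕ
      p = y₀ ℕ.∸ x₀
      -- With `b` odd and `horizon` even, section `suc b + horizon` has the even index `dbl i`: it
      -- is a single grid point, whose time is `T₀`.
      b = suc (dbl (k ℕ.* x₀))
      i = suc (k ℕ.* x₀) ℕ.+ suc (dbl Z)
      T₀ : ℚ
      T₀ = unscale (ι i)
      shifted : dbl (k ℕ.* p) ℕ.+ b ≡ suc (dbl (k ℕ.* y₀))
      shifted = begin
        dbl (k ℕ.* p) ℕ.+ suc (dbl (k ℕ.* x₀))     ≡⟨ ℕP.+-suc _ _ ⟩
        suc (dbl (k ℕ.* p) ℕ.+ dbl (k ℕ.* x₀))     ≡⟨ cong suc (sym (dbl-+ (k ℕ.* p) (k ℕ.* x₀))) ⟩
        suc (dbl (k ℕ.* p ℕ.+ k ℕ.* x₀))           ≡⟨ cong (suc ∘ dbl) (sym (ℕP.*-distribˡ-+ k p x₀)) ⟩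
        suc (dbl (k ℕ.* (p ℕ.+ x₀)))               ≡⟨ cong (λ y → suc (dbl (k ℕ.* y))) (ℕP.m∸n+n≡m (ℕP.<⇒≤ x₀<y₀)) ⟩
        suc (dbl (k ℕ.* y₀))                       ∎
        where open ≡-Reasoning
      later : ∀ x → Sec (dbl (i ℕ.+ k ℕ.* (p ℕ.* x))) (scale (T₀ Q.+ toℚ (p ℕ.* x)))
      later x = cell⇒sec (point _ (begin
        scale (T₀ Q.+ toℚ (p ℕ.* x))               ≡⟨ cong (λ q → scale (T₀ Q.+ q)) (sym (ι≡toℚ (p ℕ.* x))) ⟩
        scale (T₀ Q.+ ι (p ℕ.* x))                 ≡⟨ scale-+ T₀ (ι (p ℕ.* x)) ⟩
        scale T₀ Q.+ ι k Q.* ι (p ℕ.* x)           ≡⟨ cong₂ Q._+_ (scale-unscale (ι i)) (sym (ι-* k (p ℕ.* x))) ⟩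
        ι i Q.+ ι (k ℕ.* (p ℕ.* x))               ≡⟨ sym (ι-+ i (k ℕ.* (p ℕ.* x))) ⟩
        ι (i ℕ.+ k ℕ.* (p ℕ.* x))                 ∎))
        where open ≡-Reasoning
      now : Sec (dbl i) (scale T₀)
      now = cell⇒sec (point i (scale-unscale (ι i)))
      derivable-periodic : ∀ x a → Derivable a (dbl (i ℕ.+ k ℕ.* (p ℕ.* x))) ⇔ Derivable a (dbl i)
      derivable-periodic x a = subst₂ (λ m n → Derivable a m ⇔ Derivable a n)
        (period-index x k p x₀ Z) (sym (dbl-+ (suc (k ℕ.* x₀)) (suc (dbl Z))))
        (alike-periodic G G-grid (dbl (k ℕ.* p)) (subst (Derivation.Alike k Z 0<k _≟ᴳ_ G G-grid b) (sym shifted) alike) x a)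
      equiv : (x : ℕ) (τ : List Const) → (P ⟨ τ ⟩at (T₀ Q.+ toℚ (p ℕ.* x)) ∈ Π ⟦ D ⟧) ⇔ (P ⟨ τ ⟩at T₀ ∈ Π ⟦ D ⟧)
      equiv x τ = mk⇔
        (λ h → let l = entailed-length h in
          derivable⇒entailed l now (Equivalence.to (derivable-periodic x _) (entailed⇒derivable l (later x) h)))
        (λ h → let l = entailed-length h in
          derivable⇒entailed l (later x) (Equivalence.from (derivable-periodic x _) (entailed⇒derivable l now h)))
        where open Renaming τ

    periodic : ∀ P → Σ ℚ λ T → Σ ℕ λ n → n ℕ.> 0 ×
               ((x : ℕ) (τ : List Const) → (P ⟨ τ ⟩at (T Q.+ toℚ (n ℕ.* x)) ∈ Π ⟦ D ⟧) ⇔ (P ⟨ τ ⟩at T ∈ Π ⟦ D ⟧))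
    periodic P =
      -- Consecutive samples are `2k` cells apart, which is one unit of time; so `y₀ ∸ x₀` is a
      -- period in the original time.
      let x₀ , y₀ , x₀<y₀ , alike = alike-pair G G-grid (λ x → suc (dbl (k ℕ.* x)))
            (λ x y → odd-suc-dbl-cong (k ℕ.* x) (k ℕ.* y))
      in alike⇒periodic P x₀ y₀ x₀<y₀ alike

-- Choice of the parameters for a given program and database

open import Data.Nat using (_*_; _>_)
open import Data.Rational using (_+_)

theorem4 : (Π : Program) → IsFP Π → (D : Database) →
    (P : Pred) → PredInProgram P Π →
    Σ ℚ λ T → Σ ℕ λ n → n > 0 ×
    ((x : ℕ) (τ : List Const) →
    (P ⟨ τ ⟩at (T + toℚ (n * x)) ∈ Π ⟦ D ⟧) ⇔ (P ⟨ τ ⟩at T ∈ Π ⟦ D ⟧))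
theorem4 Π fp D P _ = Grounding.periodic Π D N
    (All.map (λ {r} → rule-mono {r = r} (ℕP.m≤m⊔n N₁ N₂)) rules-within)
    (All.map (λ {f} → fact-mono {f = f} (ℕP.m≤n⊔m N₁ N₂)) facts-within)
    k Z 0<k fp
    (All.map (λ {r} g σ → rule-grid r σ g) (AllP.map⁻ (AllP.concat⁻ (AllP.++⁻ˡ (concatMap ruleBounds Π) gridPoints))))
    (All.map (λ { {_ ⟨ _ ⟩at _} → gridI 0<k }) (AllP.map⁻ (AllP.concat⁻ (AllP.++⁻ʳ (concatMap ruleBounds Π) gridPoints))))
    P
  where
  open CommonGrid

  endpoints : List ℚ
  endpoints = concatMap ruleBounds Π ++ concatMap (bounds ∘ Fact.finterval) D

  bounded-rules : ∃ λ N → All (RuleWithin N) Π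
  bounded-rules = bound-all (λ {m} {n} {r} → rule-mono {m} {n} {r}) (All.universal rule-within Π)

  bounded-facts : ∃ λ N → All (FactWithin N) D
  bounded-facts = bound-all (λ {m} {n} {f} → fact-mono {m} {n} {f}) (All.universal fact-within D)

  N₁ N₂ N k Z : ℕ
  N₁ = proj₁ bounded-rules
  N₂ = proj₁ bounded-facts
  N  = N₁ ℕ.⊔ N₂
  rules-within = proj₂ bounded-rules
  facts-within = proj₂ bounded-facts

  k = proj₁ (common-denominator endpoints)

  0<k : 0 ℕ.< k
  0<k = proj₁ (proj₂ (common-denominator endpoints))

  bounded-endpoints : ∃ λ Z → All (Within k Z) endpoints
  bounded-endpoints = bound-all within-mono (All.map
    -- The successor is there because `Within` bounds `n` strictly.
    (λ (m , n , eq) → m ℕ.⊔ suc n , m , n , eq , ℕP.m≤m⊔n m (suc n) , ℕP.m≤n⊔m m (suc n))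
    (proj₂ (proj₂ (common-denominator endpoints))))

  Z = proj₁ bounded-endpoints

  gridPoints : All (Timeline.GridPoint k Z 0<k) endpoints
  gridPoints = All.map (within⇒gridPoint 0<k) (proj₂ bounded-endpoints)

  rule-grid : ∀ r σ → All (Timeline.GridPoint k Z 0<k) (ruleBounds r) → Derivation.GridRule k Z 0<k _≟ᴳ_ (groundRule σ r)
  rule-grid (plain _ _)      σ _ = tt
  rule-grid (boxR _ _ _)     σ g = gridI 0<k g
  rule-grid (diamondR _ _ _) σ g = gridI 0<k g
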